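{- Let $k$ be a positive integer. Every indecomposable matching with at least $(2k)^{2k}$ edges contains a broken nesting, an interleaving, or a proper pin sequence with $k$ edges.
   Context: A (labeled, complete) matching is a graph on the vertex set $[2n]=\{1,\dots,2n\}$ in which every vertex is incident to exactly one edge. An interval of a matching is a contiguous segment $[i,j]=\{i,i+1,\dots,j\}$ of vertices such that no vertex of $[i,j]$ is adjacent to a vertex outside $[i,j]$; the empty set and the whole vertex set are the trivial intervals, and a matching is indecomposable if it has no other intervals. A matching $M$ contains a matching $N$ if $N$ can be obtained from $M$ by deleting a collection of edges together with their endpoints and then relabeling the remaining vertices order-preservingly by $1,2,\dots$. The interleaving on $[2n]$ is the matching with edges $i\sim i+n$ for $i\in[n]$. The right-broken nesting on $[2n]$ has edges $n\sim 2n$ and $i\sim 2n-i$ for $i\in[n-1]$; the left-broken nesting on $[2n]$ has edges $1\sim n+1$ and $i+1\sim 2n-i+1$ for $i\in[n-1]$; a broken nesting is a left- or right-broken nesting. The shadow of a set of edges is the smallest contiguous segment of vertices containing all their endpoints. An edge splits a shadow if exactly one of its endpoints lies in that shadow. A pin sequence is a sequence of edges $p_1,p_2,\dots,p_m$ such that for each $i\ge 2$, $p_i$ splits the shadow of $\{p_1,\dots,p_{i-1}\}$; it is proper if moreover for each $i\ge 3$, $p_i$ does not split the shadow of $\{p_1,\dots,p_{i-2}\}$. A matching with $k$ edges is called a (proper) pin sequence if its $k$ edges can be ordered to form a (proper) pin sequence. -}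

module Defs where

open import Data.Nat using (ℕ; zero; suc; _+_; _*_; _∸_; _^_; _≤_; _<_; _⊓_; _⊔_; _≡ᵇ_; _≤ᵇ_)
open import Data.Bool using (if_then_else_)
open import Data.Product using (Σ; _×_; _,_)
open import Data.Sum using (_⊎_)
open import Relation.Nullary using (¬_)
open import Relation.Binary.PropositionalEquality using (_≡_; _≢_)

-- Convention: a matching on [2n] = {1,…,2n} is given by its partner
-- function p : ℕ → ℕ (only the values on 1 … 2n matter):
-- p i is the vertex adjacent to i.

InV : ℕ → ℕ → Set
InV n i = 1 ≤ i × i ≤ n + n

record IsMatching (n : ℕ) (p : ℕ → ℕ) : Set where
  field
    range : ∀ i → InV n i → InV n (p i)
    noFix : ∀ i → InV n i → p i ≢ i
    invol : ∀ i → InV n i → p (p i) ≡ i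

IsInterval : (n : ℕ) → (ℕ → ℕ) → ℕ → ℕ → Set
IsInterval n p i j =
  1 ≤ i × i ≤ j × j ≤ n + n × (∀ x → i ≤ x → x ≤ j → i ≤ p x × p x ≤ j)

Indecomposable : (n : ℕ) → (ℕ → ℕ) → Set
Indecomposable n p = ∀ i j → IsInterval n p i j → i ≡ 1 × j ≡ n + n

-- The matching q on [2m] is contained in the matching p on [2n]:
-- there is an order-preserving injection f of [2m] into [2n] whose image
-- is a union of edges of p and which carries edges of q to edges of p
-- (i.e. q is obtained from p by deleting the edges outside the image and
-- relabelling order-preservingly).
Contains : (n : ℕ) → (ℕ → ℕ) → (m : ℕ) → (ℕ → ℕ) → Set
Contains n p m q =
  Σ (ℕ → ℕ) λ f →
    (∀ i → InV m i → InV n (f i)) ×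
    (∀ i j → InV m i → InV m j → i < j → f i < f j) ×
    (∀ i → InV m i → f (q i) ≡ p (f i))

interleaving : ℕ → ℕ → ℕ
interleaving n i = if i ≤ᵇ n then i + n else i ∸ n

rightBroken : ℕ → ℕ → ℕ
rightBroken n i =
  if i ≡ᵇ n then n + n else (if i ≡ᵇ n + n then n else (n + n) ∸ i)

leftBroken : ℕ → ℕ → ℕ
leftBroken n i =
  if i ≡ᵇ 1 then suc n else (if i ≡ᵇ suc n then 1 else suc (suc (n + n)) ∸ i)

-- Pin sequences.  A sequence of edges of the matching q is given by
-- e : ℕ → ℕ, the t-th edge (t = 1, 2, …) being {e t, q (e t)}.

shLo : (ℕ → ℕ) → (ℕ → ℕ) → ℕ → ℕ
shLo q e zero = 0
shLo q e (suc zero) = e 1 ⊓ q (e 1)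
shLo q e (suc (suc s)) = shLo q e (suc s) ⊓ (e (suc (suc s)) ⊓ q (e (suc (suc s))))

shHi : (ℕ → ℕ) → (ℕ → ℕ) → ℕ → ℕ
shHi q e zero = 0
shHi q e (suc zero) = e 1 ⊔ q (e 1)
shHi q e (suc (suc s)) = shHi q e (suc s) ⊔ (e (suc (suc s)) ⊔ q (e (suc (suc s))))

InShadow : (ℕ → ℕ) → (ℕ → ℕ) → ℕ → ℕ → Set
InShadow q e s x = shLo q e s ≤ x × x ≤ shHi q e s

Splits : (ℕ → ℕ) → (ℕ → ℕ) → ℕ → ℕ → Set
Splits q e t s =
  (InShadow q e s (e t) × ¬ InShadow q e s (q (e t))) ⊎
  (¬ InShadow q e s (e t) × InShadow q e s (q (e t)))

IsEdgeOrdering : (k : ℕ) → (ℕ → ℕ) → (ℕ → ℕ) → Set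
IsEdgeOrdering k q e =
  (∀ t → 1 ≤ t → t ≤ k → InV k (e t)) ×
  (∀ t s → 1 ≤ t → t ≤ k → 1 ≤ s → s ≤ k → t ≢ s → e s ≢ e t × e s ≢ q (e t)) ×
  (∀ v → InV k v → Σ ℕ λ t → 1 ≤ t × t ≤ k × (v ≡ e t ⊎ v ≡ q (e t)))

IsProperPinSeq : (k : ℕ) → (ℕ → ℕ) → Set
IsProperPinSeq k q =
  Σ (ℕ → ℕ) λ e →
    IsEdgeOrdering k q e ×
    (∀ i → 2 ≤ i → i ≤ k → Splits q e i (i ∸ 1)) ×
    (∀ i → 3 ≤ i → i ≤ k → ¬ Splits q e i (i ∸ 2))

{-# OPTIONS --safe #-}
module Submission where

-- Two edges are adjacent in the crossing graph if they cross; indecomposability makes this graph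
-- connected.  If an edge crosses many others, many of these leave it on the same side, and by
-- Erdős–Szekeres k of them are pairwise crossing (an interleaving) or k − 1 are nested (with the
-- edge itself, a broken nesting).  Otherwise degrees are at most 4(k − 1)², counted by vertices,
-- so breadth-first search from the edge at vertex 1 reaches distance k − 1.  A shortest path from
-- there back to the edge at vertex 1 is a proper pin sequence: it is induced, so an edge does not
-- split the shadow of those at least two steps before it, and an edge that stayed inside the
-- shadow of its predecessors would cut the rest of the path off from vertex 1.

open import Defs
open import Data.Nat using (ℕ; zero; suc; pred; _+_; _*_; _∸_; _^_; _≤_; _<_; _⊓_; _⊔_; _≤ᵇ_; _≡ᵇ_; z≤n; s≤s; z<s; s<s; s≤s⁻¹; s<s⁻¹)
open import Data.Nat.Properties
open import Data.Nat.Solver using (module +-*-Solver)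
open import Data.Bool using (true; false; T; if_then_else_)
open import Data.Empty using (⊥; ⊥-elim)
open import Data.List using (List; []; _∷_; _++_; length; map; filter; concatMap; applyUpTo)
open import Data.List.Properties using (length-++; length-map; length-applyUpTo)
open import Data.List.Membership.Propositional using (_∈_; _∉_; lose; find)
open import Data.List.Membership.Propositional.Properties
open import Data.List.Membership.DecPropositional _≟_ using (_∈?_)
open import Data.List.Relation.Binary.Subset.Propositional using (_⊆_)
open import Data.List.Relation.Unary.All as All using (All; []; _∷_; all?)
open import Data.List.Relation.Unary.All.Properties using (¬All⇒Any¬)
open import Data.List.Relation.Unary.Any using (here; there; any?)
open import Data.List.Relation.Unary.AllPairs as AllPairs using (AllPairs; []; _∷_)
import Data.List.Relation.Unary.AllPairs.Properties as AllPairsₚ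
open import Data.List.Relation.Unary.Unique.Propositional using (Unique)
open import Data.Product using (Σ; _×_; _,_; proj₁; proj₂)
open import Data.Sum using (_⊎_; inj₁; inj₂; [_,_]′)
open import Function using (_∘_; id)
open import Relation.Nullary using (¬_; Dec; yes; no; contradiction)
open import Relation.Nullary.Decidable using (_×-dec_; ¬?; decidable-stable)
open import Relation.Binary.Definitions using (tri<; tri≈; tri>)
open import Relation.Binary.PropositionalEquality using (_≡_; _≢_; refl; sym; trans; cong; cong₂; subst; subst₂)

-- An induced path in the crossing graph need not be a pin sequence: each edge crosses the one
-- before it, but it may lie entirely within the shadow of all earlier ones. Anchoring the search at
-- the vertex 1 excludes this, because a shadow of edges other than the one at 1 cannot contain the
-- vertex 1. For the same reason the sequence is listed from the far end towards the root, against
-- the order of the search. The constants arise as follows. Put j = k - 1. Erdős-Szekeres allows at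
-- most j² edges to leave a given edge on each side, so at most 2j² edges cross it, and each is
-- recorded with both endpoints. The ball of radius d therefore has at most 2(1 + 4j²)^d vertices,
-- the 2 being the endpoints of the root edge. It cancels against the 2n vertices of the matching,
-- so the layer at distance j is nonempty once n > (1 + 4j²)^j, and 1 + 4j² ≤ (2k)² brings this
-- below (2k)^(2k).

-- Lists of natural numbers

-- Past the end, nth returns d; with d an upper bound of a sorted list this keeps nth monotone.
nth : ℕ → List ℕ → ℕ → ℕ
nth d []       i       = d
nth d (x ∷ xs) zero    = x
nth d (x ∷ xs) (suc i) = nth d xs i

nth-∈ : ∀ d xs {i} → i < length xs → nth d xs i ∈ xs
nth-∈ d (x ∷ xs) {zero}  i<    = here refl
nth-∈ d (x ∷ xs) {suc i} i<    = there (nth-∈ d xs (s<s⁻¹ i<))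

nth-AllPairs : ∀ {R : ℕ → ℕ → Set} d {xs} → AllPairs R xs →
               ∀ {i j} → i < j → j < length xs → R (nth d xs i) (nth d xs j)
nth-AllPairs d {x ∷ xs} (Rx ∷ Rxs) {zero}  {suc j} _   j< = All.lookup Rx (nth-∈ d xs (s<s⁻¹ j<))
nth-AllPairs d {x ∷ xs} (Rx ∷ Rxs) {suc i} {suc j} i<j j< = nth-AllPairs d Rxs (s<s⁻¹ i<j) (s<s⁻¹ j<)

nth-mono : ∀ {d xs} → All (_≤ d) xs → AllPairs _<_ xs → ∀ {i j} → i ≤ j → nth d xs i ≤ nth d xs j
nth-mono []           []         _         = ≤-refl
nth-mono (_ ∷ _)      (_ ∷ _)    {zero} {zero} _ = ≤-refl
nth-mono {d} {x ∷ xs} (x≤d ∷ xs≤d) (x< ∷ s) {zero} {suc j} _ = below xs≤d x< j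
  where
  below : ∀ {ys} → All (_≤ d) ys → All (x <_) ys → ∀ j → x ≤ nth d ys j
  below []      []        j       = x≤d
  below (_ ∷ _) (lt ∷ _)  zero    = <⇒≤ lt
  below (_ ∷ b) (_ ∷ lts) (suc j) = below b lts j
nth-mono (_ ∷ xs≤d)   (_ ∷ s)    (s≤s i≤j) = nth-mono xs≤d s i≤j

position : ℕ → List ℕ → ℕ
position x []       = 0
position x (y ∷ ys) with x ≟ y
... | yes _ = 0
... | no  _ = suc (position x ys)

position-< : ∀ {x xs} → x ∈ xs → position x xs < length xs
position-< {x} {y ∷ ys} x∈ with x ≟ y
... | yes _ = z<s
position-< {x} {y ∷ ys} (here x≡y) | no x≢y = contradiction x≡y x≢y
position-< {x} {y ∷ ys} (there x∈) | no _   = s<s (position-< x∈)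

nth-position : ∀ d {x xs} → x ∈ xs → nth d xs (position x xs) ≡ x
nth-position d {x} {y ∷ ys} x∈ with x ≟ y
... | yes x≡y = sym x≡y
nth-position d {x} {y ∷ ys} (here x≡y) | no x≢y = contradiction x≡y x≢y
nth-position d {x} {y ∷ ys} (there x∈) | no _   = nth-position d x∈

Unique-⊆⇒length≤ : ∀ {xs ys : List ℕ} → Unique xs → xs ⊆ ys → length xs ≤ length ys
Unique-⊆⇒length≤ {[]}     _         _  = z≤n
Unique-⊆⇒length≤ {x ∷ xs} (x∉ ∷ u) xs⊆ with ∈-∃++ (xs⊆ (here refl))
... | as , bs , refl = begin
    suc (length xs)             ≤⟨ s≤s (Unique-⊆⇒length≤ u avoid) ⟩
    suc (length (as ++ bs))     ≡⟨ cong suc (length-++ as) ⟩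
    suc (length as + length bs) ≡⟨ +-suc (length as) (length bs) ⟨
    length as + length (x ∷ bs) ≡⟨ length-++ as ⟨
    length (as ++ x ∷ bs)       ∎
  where
  open ≤-Reasoning
  avoid : xs ⊆ as ++ bs
  avoid y∈ with ∈-++⁻ as (xs⊆ (there y∈))
  ... | inj₁ y∈as         = ∈-++⁺ˡ y∈as
  ... | inj₂ (here refl)  = contradiction refl (All.lookup x∉ y∈)
  ... | inj₂ (there y∈bs) = ∈-++⁺ʳ as y∈bs

<-sorted⇒Unique : ∀ {xs} → AllPairs _<_ xs → Unique xs
<-sorted⇒Unique = AllPairs.map <⇒≢

-- The Erdős–Szekeres theorem

-- A function on indices rather than a list: the pattern embeddings index it directly, and a shorter
-- chain is the same function with a smaller bound.
Chain : (ℕ → ℕ → Set) → List ℕ → ℕ → Set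
Chain R xs r = Σ (ℕ → ℕ) λ g →
  (∀ {i} → i < r → g i ∈ xs) × (∀ {i j} → i < j → j < r → R (g i) (g j))

module ErdősSzekeres (p : ℕ → ℕ) where

  -- `Up` is weak in `p`, so that any `x < y` is in exactly one of the two relations without
  -- injectivity of `p`. On vertices of a matching `Up⇒<` makes it strict.
  Up Down : ℕ → ℕ → Set
  Up   x y = x < y × p x ≤ p y
  Down x y = x < y × p y < p x

  -- The left-to-right minima of p on c ∷ xs other than c, and the remaining elements.
  minima others : ℕ → List ℕ → List ℕ
  minima c []       = []
  minima c (x ∷ xs) with p x <? p c
  ... | yes _ = x ∷ minima x xs
  ... | no  _ = minima c xs
  others c []       = []
  others c (x ∷ xs) with p x <? p c
  ... | yes _ = others x xs
  ... | no  _ = x ∷ others c xs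

  length-split : ∀ c xs → length (minima c xs) + length (others c xs) ≡ length xs
  length-split c []       = refl
  length-split c (x ∷ xs) with p x <? p c
  ... | yes _ = cong suc (length-split x xs)
  ... | no  _ = trans (+-suc (length (minima c xs)) _) (cong suc (length-split c xs))

  minima-⊆ : ∀ c xs → minima c xs ⊆ xs
  minima-⊆ c (x ∷ xs) y∈ with p x <? p c
  minima-⊆ c (x ∷ xs) (here refl) | yes _ = here refl
  minima-⊆ c (x ∷ xs) (there y∈)  | yes _ = there (minima-⊆ x xs y∈)
  minima-⊆ c (x ∷ xs) y∈          | no  _ = there (minima-⊆ c xs y∈)

  others-⊆ : ∀ c xs → others c xs ⊆ xs
  others-⊆ c (x ∷ xs) y∈ with p x <? p c
  others-⊆ c (x ∷ xs) y∈          | yes _ = there (others-⊆ x xs y∈)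
  others-⊆ c (x ∷ xs) (here refl) | no  _ = here refl
  others-⊆ c (x ∷ xs) (there y∈)  | no  _ = there (others-⊆ c xs y∈)

  minima-Down : ∀ c xs → AllPairs _<_ (c ∷ xs) → AllPairs Down (c ∷ minima c xs)
  minima-Down c []       _ = [] ∷ []
  minima-Down c (x ∷ xs) ((c<x ∷ c<) ∷ (x< ∷ s)) with p x <? p c
  ... | no  _     = minima-Down c xs (c< ∷ s)
  ... | yes px<pc with minima-Down x xs (x< ∷ s)
  ...   | dx ∷ ds = ((c<x , px<pc) ∷ All.map (λ { (x<y , py<px) → <-trans c<x x<y , <-trans py<px px<pc }) dx) ∷ dx ∷ ds

  others-sorted : ∀ c xs → AllPairs _<_ xs → AllPairs _<_ (others c xs)
  others-sorted c []       _ = []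
  others-sorted c (x ∷ xs) (x< ∷ s) with p x <? p c
  ... | yes _ = others-sorted x xs s
  ... | no  _ = All.tabulate (All.lookup x< ∘ others-⊆ c xs) ∷ others-sorted c xs s

  others-above : ∀ c xs → AllPairs _<_ (c ∷ xs) → ∀ {y} → y ∈ others c xs →
                 Σ ℕ λ x → x ∈ c ∷ xs × Up x y
  others-above c (x ∷ xs) ((c<x ∷ c<) ∷ (x< ∷ s)) y∈ with p x <? p c
  others-above c (x ∷ xs) ((c<x ∷ c<) ∷ (x< ∷ s)) y∈ | yes _ with others-above x xs (x< ∷ s) y∈
  ... | z , z∈ , up = z , there z∈ , up
  others-above c (x ∷ xs) ((c<x ∷ c<) ∷ (x< ∷ s)) (here refl) | no px≮pc = c , here refl , c<x , ≮⇒≥ px≮pc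
  others-above c (x ∷ xs) ((c<x ∷ c<) ∷ (x< ∷ s)) (there y∈)  | no _ with others-above c xs (c< ∷ s) y∈
  ... | z , here refl , up = z , here refl , up
  ... | z , there z∈  , up = z , there (there z∈) , up

  Up-cons : ∀ {xs ys r} → ys ⊆ xs → (∀ {y} → y ∈ ys → Σ ℕ λ x → x ∈ xs × Up x y) →
            Chain Up ys (suc r) → Chain Up xs (suc (suc r))
  Up-cons {xs} {ys} {r} ys⊆ below (g , g∈ , g-up) = h , h∈ , h-up
    where
    x  = proj₁ (below (g∈ z<s))
    x∈ = proj₁ (proj₂ (below (g∈ z<s)))
    xg = proj₂ (proj₂ (below (g∈ z<s)))
    h : ℕ → ℕ
    h zero    = x
    h (suc i) = g i
    h∈ : ∀ {i} → i < suc (suc r) → h i ∈ xs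
    h∈ {zero}  _  = x∈
    h∈ {suc i} i< = ys⊆ (g∈ (s<s⁻¹ i<))
    h-up : ∀ {i j} → i < j → j < suc (suc r) → Up (h i) (h j)
    h-up {zero}  {suc zero}    _   _  = xg
    h-up {zero}  {suc (suc j)} _   j< with g-up {0} {suc j} z<s (s<s⁻¹ j<)
    ... | lt , le = <-trans (proj₁ xg) lt , ≤-trans (proj₂ xg) le
    h-up {suc i} {suc j}       i<j j< = g-up (s<s⁻¹ i<j) (s<s⁻¹ j<)

  -- Either there are more than s left-to-right minima, or the induction hypothesis applies to the
  -- other elements, and an increasing chain in them is extended downwards by a minimum.
  erdős-szekeres : ∀ r s xs → AllPairs _<_ xs → r * s < length xs →
                   Chain Up xs (suc r) ⊎ Chain Down xs (suc s)
  erdős-szekeres zero s (x ∷ xs) _ _ = inj₁ ((λ _ → x) , (λ _ → here refl) , trivial)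
    where
    trivial : ∀ {i j} → i < j → j < 1 → Up x x
    trivial {j = zero}  () _
    trivial {j = suc _} _  (s≤s ())
  erdős-szekeres (suc r) s (c ∷ xs) sorted@(_ ∷ tail-sorted) big
    with s <? length (c ∷ minima c xs)
  ... | yes many = inj₂ (nth c ms , ms∈ , λ i<j j≤s → nth-AllPairs c (minima-Down c xs sorted) i<j (<-≤-trans j≤s many))
    where
    ms = c ∷ minima c xs
    ms⊆ : ms ⊆ c ∷ xs
    ms⊆ (here refl) = here refl
    ms⊆ (there y∈)  = there (minima-⊆ c xs y∈)
    ms∈ : ∀ {i} → i < suc s → nth c ms i ∈ c ∷ xs
    ms∈ i≤s = ms⊆ (nth-∈ c ms (<-≤-trans i≤s many))
  ... | no few with erdős-szekeres r s (others c xs) (others-sorted c xs tail-sorted) enough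
    where
    open ≤-Reasoning
    enough : r * s < length (others c xs)
    enough = +-cancelˡ-< (length (c ∷ minima c xs)) _ _ (begin-strict
      length (c ∷ minima c xs) + r * s                   ≤⟨ +-monoˡ-≤ (r * s) (≮⇒≥ few) ⟩
      s + r * s                                          <⟨ big ⟩
      length (c ∷ xs)                                    ≡⟨ cong suc (length-split c xs) ⟨
      length (c ∷ minima c xs) + length (others c xs)    ∎)
  ...   | inj₁ up               = inj₁ (Up-cons (there ∘ others-⊆ c xs) (others-above c xs sorted) up)
  ...   | inj₂ (g , g∈ , down)  = inj₂ (g , there ∘ others-⊆ c xs ∘ g∈ , down)

-- Chords and crossings

module Chords {n : ℕ} {p : ℕ → ℕ} (M : IsMatching n p) where
  open IsMatching M

  V : ℕ → Set
  V = InV n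

  -- A vertex stands for the edge at it, so `v` and `p v` name the same chord. The lemmas with `-p`
  -- in their names move between the two names.
  lo hi : ℕ → ℕ
  lo v = v ⊓ p v
  hi v = v ⊔ p v

  Inside : ℕ → ℕ → Set
  Inside v x = lo v < x × x < hi v

  inside? : ∀ v x → Dec (Inside v x)
  inside? v x = (lo v <? x) ×-dec (x <? hi v)

  Cross : ℕ → ℕ → Set
  Cross v w = (Inside v w × ¬ Inside v (p w)) ⊎ (¬ Inside v w × Inside v (p w))

  p-injective : ∀ {v w} → V v → V w → p v ≡ p w → v ≡ w
  p-injective Vv Vw eq = trans (sym (invol _ Vv)) (trans (cong p eq) (invol _ Vw))

  lo-p : ∀ {v} → V v → lo (p v) ≡ lo v
  lo-p {v} Vv = trans (cong (p v ⊓_) (invol v Vv)) (⊓-comm (p v) v)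

  hi-p : ∀ {v} → V v → hi (p v) ≡ hi v
  hi-p {v} Vv = trans (cong (p v ⊔_) (invol v Vv)) (⊔-comm (p v) v)

  ends : ∀ v → (lo v ≡ v × hi v ≡ p v) ⊎ (lo v ≡ p v × hi v ≡ v)
  ends v with ≤-total v (p v)
  ... | inj₁ v≤pv = inj₁ (m≤n⇒m⊓n≡m v≤pv , m≤n⇒m⊔n≡n v≤pv)
  ... | inj₂ pv≤v = inj₂ (m≥n⇒m⊓n≡n pv≤v , m≥n⇒m⊔n≡m pv≤v)

  Inside-p : ∀ {v x} → V v → Inside v x → Inside (p v) x
  Inside-p {v} {x} Vv (l , h) = subst (_< x) (sym (lo-p Vv)) l , subst (x <_) (sym (hi-p Vv)) h

  Inside-p⁻ : ∀ {v x} → V v → Inside (p v) x → Inside v x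
  Inside-p⁻ {v} {x} Vv (l , h) = subst (_< x) (lo-p Vv) l , subst (x <_) (hi-p Vv) h

  Inside⇒≢ : ∀ {v x} → Inside v x → x ≢ v × x ≢ p v
  Inside⇒≢ {v} (l , h) with ends v
  ... | inj₁ (lo≡ , hi≡) = (λ { refl → <-irrefl lo≡ l }) , (λ { refl → <-irrefl (sym hi≡) h })
  ... | inj₂ (lo≡ , hi≡) = (λ { refl → <-irrefl (sym hi≡) h }) , (λ { refl → <-irrefl lo≡ l })

  end-≡ : ∀ {v x} → x ≡ lo v ⊎ x ≡ hi v → x ≡ v ⊎ x ≡ p v
  end-≡ {v} e with ends v | e
  ... | inj₁ (lo≡ , hi≡) | inj₁ eq = inj₁ (trans eq lo≡)
  ... | inj₁ (lo≡ , hi≡) | inj₂ eq = inj₂ (trans eq hi≡)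
  ... | inj₂ (lo≡ , hi≡) | inj₁ eq = inj₂ (trans eq lo≡)
  ... | inj₂ (lo≡ , hi≡) | inj₂ eq = inj₁ (trans eq hi≡)

  partner-≢-end : ∀ {v w} → V v → V w → Inside v w → p w ≢ lo v × p w ≢ hi v
  partner-≢-end {v} {w} Vv Vw in-v = (λ eq → absurd (inj₁ eq)) , (λ eq → absurd (inj₂ eq))
    where
    absurd : p w ≡ lo v ⊎ p w ≡ hi v → ⊥
    absurd e with end-≡ e
    ... | inj₁ pw≡v  = proj₂ (Inside⇒≢ in-v) (trans (sym (invol w Vw)) (cong p pw≡v))
    ... | inj₂ pw≡pv = proj₁ (Inside⇒≢ in-v) (p-injective Vw Vv pw≡pv)

  Cross-pʳ : ∀ {v w} → V w → Cross v w → Cross v (p w)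
  Cross-pʳ {v} {w} Vw (inj₁ (i , o)) = inj₂ (o , subst (Inside v) (sym (invol w Vw)) i)
  Cross-pʳ {v} {w} Vw (inj₂ (o , i)) = inj₁ (i , o ∘ subst (Inside v) (invol w Vw))

  Cross-pʳ⁻ : ∀ {v w} → V w → Cross v (p w) → Cross v w
  Cross-pʳ⁻ {v} {w} Vw c = subst (Cross v) (invol w Vw) (Cross-pʳ (range w Vw) c)

  Cross-pˡ⁻ : ∀ {v w} → V v → Cross (p v) w → Cross v w
  Cross-pˡ⁻ Vv (inj₁ (i , o)) = inj₁ (Inside-p⁻ Vv i , o ∘ Inside-p Vv)
  Cross-pˡ⁻ Vv (inj₂ (o , i)) = inj₂ (o ∘ Inside-p Vv , Inside-p⁻ Vv i)

  ends-separated⇒Cross : ∀ {v w} →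
    (Inside w (lo v) × ¬ Inside w (hi v)) ⊎ (¬ Inside w (lo v) × Inside w (hi v)) → Cross w v
  ends-separated⇒Cross {v} {w} s with ends v | s
  ... | inj₁ (l , h) | inj₁ (i , o) = inj₁ (subst (Inside w) l i , o ∘ subst (Inside w) (sym h))
  ... | inj₁ (l , h) | inj₂ (o , i) = inj₂ (o ∘ subst (Inside w) (sym l) , subst (Inside w) h i)
  ... | inj₂ (l , h) | inj₁ (i , o) = inj₂ (o ∘ subst (Inside w) (sym h) , subst (Inside w) l i)
  ... | inj₂ (l , h) | inj₂ (o , i) = inj₁ (subst (Inside w) h i , o ∘ subst (Inside w) (sym l))

  -- Exchanging `w` and `p w` reduces to the case where `w` is the end inside the chord at `v`. Then
  -- `p w` is neither inside nor an end of that chord, so it lies beyond exactly one of `lo v` and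
  -- `hi v`, and only that end falls between `w` and `p w`.
  Cross-sym : ∀ {v w} → V v → V w → Cross v w → Cross w v
  Cross-sym {v} {w} Vv Vw (inj₂ (o , i)) =
    Cross-pˡ⁻ Vw (Cross-sym Vv (range w Vw) (inj₁ (i , o ∘ subst (Inside v) (invol w Vw))))
  Cross-sym {v} {w} Vv Vw (inj₁ (i@(l<w , w<h) , o)) with p w <? lo v | hi v <? p w
  ... | yes pw<l | _ = ends-separated⇒Cross (inj₁
      ( (subst (_< lo v) (sym (m≥n⇒m⊓n≡n pw≤w)) pw<l , subst (lo v <_) (sym (m≥n⇒m⊔n≡m pw≤w)) l<w)
      , λ (_ , h<) → <-asym w<h (subst (hi v <_) (m≥n⇒m⊔n≡m pw≤w) h<)))
    where pw≤w = <⇒≤ (<-trans pw<l l<w)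
  ... | no _ | yes h<pw = ends-separated⇒Cross (inj₂
      ( (λ (<l , _) → <-asym l<w (subst (_< lo v) (m≤n⇒m⊓n≡m w≤pw) <l))
      , (subst (_< hi v) (sym (m≤n⇒m⊓n≡m w≤pw)) w<h , subst (hi v <_) (sym (m≤n⇒m⊔n≡n w≤pw)) h<pw)))
    where w≤pw = <⇒≤ (<-trans w<h h<pw)
  ... | no pw≮l | no h≮pw = contradiction
      (≤∧≢⇒< (≮⇒≥ pw≮l) (proj₁ ≢ends ∘ sym) , ≤∧≢⇒< (≮⇒≥ h≮pw) (proj₂ ≢ends)) o
    where ≢ends = partner-≢-end Vv Vw i

  -- If the chord at `v` told two points of `A` apart, one of its ends would lie between them and
  -- hence in `A`. It is applied with `A` the inside of a chord, to show that indecomposability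
  -- connects the crossing graph, and with `A` a shadow.
  convex-separates : ∀ {A : ℕ → Set} → (∀ {x y z} → A x → A z → x ≤ y → y ≤ z → A y) →
    ∀ {v w} → ¬ A v → ¬ A (p v) → A w → A (p w) → ¬ Cross v w
  convex-separates {A} convex {v} {w} v∉ pv∉ w∈ pw∈ = λ
    { (inj₁ (i , o)) → o (closed w∈ pw∈ i)
    ; (inj₂ (o , i)) → o (closed pw∈ w∈ i) }
    where
    end∉ : ∀ {x} → x ≡ lo v ⊎ x ≡ hi v → ¬ A x
    end∉ e with end-≡ e
    ... | inj₁ refl = v∉
    ... | inj₂ refl = pv∉
    closed : ∀ {x y} → A x → A y → Inside v x → Inside v y
    closed x∈ y∈ (l<x , x<h) =
      ≰⇒> (λ y≤l → end∉ (inj₁ refl) (convex y∈ x∈ y≤l (<⇒≤ l<x))) ,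
      ≰⇒> (λ h≤y → end∉ (inj₂ refl) (convex x∈ y∈ (<⇒≤ x<h) h≤y))

  Inside-convex : ∀ v {x y z} → Inside v x → Inside v z → x ≤ y → y ≤ z → Inside v y
  Inside-convex v (l<x , _) (_ , z<h) x≤y y≤z = <-≤-trans l<x x≤y , ≤-<-trans y≤z z<h

  between⇒Inside : ∀ {v x y} → (x ≡ v × y ≡ p v) ⊎ (x ≡ p v × y ≡ v) → ∀ {z} → x < z → z < y → Inside v z
  between⇒Inside {v} (inj₁ (refl , refl)) x<z z<y = m<n⇒m⊓o<n (p v) x<z , m<n⇒m<o⊔n v z<y
  between⇒Inside {v} (inj₂ (refl , refl)) x<z z<y = m<n⇒o⊓m<n v x<z , m<n⇒m<n⊔o (p v) z<y

  vertices : List ℕ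
  vertices = applyUpTo suc (n + n)

  ∈-vertices : ∀ {v} → V v → v ∈ vertices
  ∈-vertices {suc v} (_ , v<) = ∈-applyUpTo⁺ suc v<

  ∈-vertices⁻ : ∀ {v} → v ∈ vertices → V v
  ∈-vertices⁻ v∈ with ∈-applyUpTo⁻ suc v∈
  ... | i , i< , refl = s≤s z≤n , i<

  vertices-sorted : AllPairs _<_ vertices
  vertices-sorted = AllPairsₚ.applyUpTo⁺₁ suc (n + n) (λ i<j _ → s<s i<j)

-- Distance from the edge at the first vertex in the crossing graph

module Layers {n : ℕ} {p : ℕ → ℕ} (M : IsMatching n p) (1≤n : 1 ≤ n) where
  open IsMatching M
  open Chords M

  V1 : V 1
  V1 = ≤-refl , ≤-trans 1≤n (m≤m+n n n)

  -- `arcs` records a crossing edge by its end inside the chord, sorted by the side on which it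
  -- leaves; this is the form that Erdős-Szekeres needs. `neighbours` adds the outer ends, so that
  -- balls are closed under `p`.
  rightArcs leftArcs arcs neighbours : ℕ → List ℕ
  rightArcs v = filter (λ x → inside? v x ×-dec (hi v <? p x)) vertices
  leftArcs  v = filter (λ x → inside? v x ×-dec (p x <? lo v)) vertices
  arcs v = rightArcs v ++ leftArcs v
  neighbours v = arcs v ++ map p (arcs v)

  ball : ℕ → List ℕ
  ball zero    = 1 ∷ p 1 ∷ []
  ball (suc d) = ball d ++ concatMap neighbours (ball d)

  ∈-arcs : ∀ {v x} → V v → V x → Inside v x → ¬ Inside v (p x) → x ∈ arcs v
  ∈-arcs {v} {x} Vv Vx i o with p x <? lo v | hi v <? p x
  ... | yes px<l | _        = ∈-++⁺ʳ (rightArcs v) (∈-filter⁺ _ (∈-vertices Vx) (i , px<l))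
  ... | no _     | yes h<px = ∈-++⁺ˡ (∈-filter⁺ _ (∈-vertices Vx) (i , h<px))
  ... | no px≮l  | no h≮px  = contradiction
      (≤∧≢⇒< (≮⇒≥ px≮l) (proj₁ ≢ends ∘ sym) , ≤∧≢⇒< (≮⇒≥ h≮px) (proj₂ ≢ends)) o
    where ≢ends = partner-≢-end Vv Vx i

  ∈-rightArcs⁻ : ∀ v {x} → x ∈ rightArcs v → V x × Inside v x × hi v < p x
  ∈-rightArcs⁻ v x∈ with ∈-filter⁻ (λ x → inside? v x ×-dec (hi v <? p x)) {xs = vertices} x∈
  ... | x∈V , arc = ∈-vertices⁻ x∈V , arc

  ∈-leftArcs⁻ : ∀ v {x} → x ∈ leftArcs v → V x × Inside v x × p x < lo v
  ∈-leftArcs⁻ v x∈ with ∈-filter⁻ (λ x → inside? v x ×-dec (p x <? lo v)) {xs = vertices} x∈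
  ... | x∈V , arc = ∈-vertices⁻ x∈V , arc

  ∈-arcs⁻ : ∀ {v x} → x ∈ arcs v → V x × Inside v x × ¬ Inside v (p x)
  ∈-arcs⁻ {v} x∈ with ∈-++⁻ (rightArcs v) x∈
  ... | inj₁ x∈r = let (Vx , i , h<px) = ∈-rightArcs⁻ v x∈r in Vx , i , λ (_ , px<h) → <-asym px<h h<px
  ... | inj₂ x∈l = let (Vx , i , px<l) = ∈-leftArcs⁻ v x∈l in Vx , i , λ (l<px , _) → <-asym l<px px<l

  Cross⇒neighbour : ∀ {v x} → V v → V x → Cross v x → x ∈ neighbours v
  Cross⇒neighbour Vv Vx (inj₁ (i , o)) = ∈-++⁺ˡ (∈-arcs Vv Vx i o)
  Cross⇒neighbour {v} {x} Vv Vx (inj₂ (o , i)) = ∈-++⁺ʳ (arcs v)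
    (subst (_∈ map p (arcs v)) (invol x Vx)
      (∈-map⁺ p (∈-arcs Vv (range x Vx) i (o ∘ subst (Inside v) (invol x Vx)))))

  neighbour⇒Cross : ∀ {v x} → x ∈ neighbours v → V x × Cross v x
  neighbour⇒Cross {v} {x} x∈ with ∈-++⁻ (arcs v) x∈
  ... | inj₁ x∈a with ∈-arcs⁻ x∈a
  ...   | Vx , i , o = Vx , inj₁ (i , o)
  neighbour⇒Cross {v} {x} x∈ | inj₂ x∈m with ∈-map⁻ p x∈m
  ...   | y , y∈ , refl with ∈-arcs⁻ y∈
  ...     | Vy , i , o = range y Vy , inj₂ (o , subst (Inside v) (sym (invol y Vy)) i)

  ball-V : ∀ d {v} → v ∈ ball d → V v
  ball-V zero    (here refl)         = V1
  ball-V zero    (there (here refl)) = range 1 V1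
  ball-V (suc d) v∈ with ∈-++⁻ (ball d) v∈
  ... | inj₁ v∈d = ball-V d v∈d
  ... | inj₂ v∈n with find (∈-concatMap⁻ neighbours {xs = ball d} v∈n)
  ...   | u , _ , v∈u = proj₁ (neighbour⇒Cross v∈u)

  ball-step : ∀ d {u v} → u ∈ ball d → V v → Cross u v → v ∈ ball (suc d)
  ball-step d u∈ Vv c =
    ∈-++⁺ʳ (ball d) (∈-concatMap⁺ neighbours {xs = ball d} (lose u∈ (Cross⇒neighbour (ball-V d u∈) Vv c)))

  ball-step⁻ : ∀ d {v} → v ∈ ball (suc d) → v ∈ ball d ⊎ Σ ℕ λ u → u ∈ ball d × Cross u v
  ball-step⁻ d v∈ with ∈-++⁻ (ball d) v∈
  ... | inj₁ v∈d = inj₁ v∈d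
  ... | inj₂ v∈n with find (∈-concatMap⁻ neighbours {xs = ball d} v∈n)
  ...   | u , u∈ , v∈u = inj₂ (u , u∈ , proj₂ (neighbour⇒Cross v∈u))

  ball-p : ∀ d {v} → v ∈ ball d → p v ∈ ball d
  ball-p zero    (here refl)         = there (here refl)
  ball-p zero    (there (here refl)) = here (invol 1 V1)
  ball-p (suc d) v∈ with ball-step⁻ d v∈
  ... | inj₁ v∈d          = ∈-++⁺ˡ (ball-p d v∈d)
  ... | inj₂ (u , u∈ , c) = ball-step d u∈ (range _ (ball-V (suc d) v∈)) (Cross-pʳ (ball-V (suc d) v∈) c)

  ball-mono : ∀ {d e} → d ≤ e → ball d ⊆ ball e
  ball-mono {d} {e} d≤e {v} v∈ = subst (λ m → v ∈ ball m) (m+[n∸m]≡n d≤e) (grow (e ∸ d))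
    where
    grow : ∀ m → v ∈ ball (d + m)
    grow zero    = subst (λ m → v ∈ ball m) (sym (+-identityʳ d)) v∈
    grow (suc m) = subst (λ m → v ∈ ball m) (sym (+-suc d m)) (∈-++⁺ˡ (grow m))

  module _ (indec : Indecomposable n p) (D : ℕ) (stable : ∀ {v} → v ∈ ball (suc D) → v ∈ ball D) where

    private
      S : ℕ → Set
      S v = v ∈ ball D

      -- A vertex z outside the ball spans no chord over a vertex of the ball: the ball is
      -- crossing-connected, contains the vertex 1, and the chord at z crosses no chord of it.
      ball-avoids : ∀ {z} → V z → ¬ S z → ∀ d → d ≤ D → ∀ {v} → v ∈ ball d → ¬ Inside z v
      ball-avoids {z} Vz z∉ = go
        where
        no-cross : ∀ {v} → S v → ¬ Cross z v
        no-cross v∈ c = z∉ (stable (ball-step D v∈ Vz (Cross-sym Vz (ball-V D v∈) c)))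
        partner-in : ∀ {v} → S v → Inside z v → Inside z (p v)
        partner-in v∈ i = decidable-stable (inside? z _) (λ o → no-cross v∈ (inj₁ (i , o)))
        1∉ : ¬ Inside z 1
        1∉ (l<1 , _) = <⇒≱ l<1 (⊓-glb (proj₁ Vz) (proj₁ (range z Vz)))
        go : ∀ d → d ≤ D → ∀ {v} → v ∈ ball d → ¬ Inside z v
        go zero    d≤D (here refl)         = 1∉
        go zero    d≤D (there (here refl)) i =
          1∉ (subst (Inside z) (invol 1 V1) (partner-in (ball-mono d≤D (there (here refl))) i))
        go (suc d) d≤D v∈ i with ball-step⁻ d v∈
        ... | inj₁ v∈d          = go d (<⇒≤ d≤D) v∈d i
        ... | inj₂ (u , u∈ , c) = convex-separates (Inside-convex z)
          (go d (<⇒≤ d≤D) u∈) (go d (<⇒≤ d≤D) (ball-p d u∈)) i (partner-in (ball-mono d≤D v∈) i) c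

      gap-below : ∀ x → 1 ≤ x → ¬ S x →
                  Σ ℕ λ s → s < x × S s × (∀ z → s < z → z ≤ x → ¬ S z)
      gap-below (suc x) _ x∉ with x ∈? ball D
      ... | yes x∈ = x , ≤-refl , x∈ , λ z x<z z≤ → subst (¬_ ∘ S) (≤-antisym x<z z≤) x∉
      ... | no  x'∉ with x
      ...   | zero  = contradiction (ball-mono (z≤n {D}) (here refl)) x∉
      ...   | suc x' with gap-below (suc x') (s≤s z≤n) x'∉
      ...     | s , s<x , s∈ , none = s , m<n⇒m<1+n s<x , s∈ , none′
        where
        none′ : ∀ z → s < z → z ≤ suc (suc x') → ¬ S z
        none′ z s<z z≤ with m≤n⇒m<n∨m≡n z≤
        ... | inj₁ z<   = none z s<z (s≤s⁻¹ z<)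
        ... | inj₂ refl = x∉

      -- Downwards the vertex 1 always stops the gap, but upwards there may be no further vertex of
      -- the ball. Hence the gap may run up to `n + n`, and its upper neighbour is asserted only
      -- conditionally. The argument `m` counts the vertices above `x` and drives the recursion.
      gap-above : ∀ m x → x + m ≡ n + n → ¬ S x →
                  Σ ℕ λ t → x ≤ t × t ≤ n + n × (∀ z → x ≤ z → z ≤ t → ¬ S z) × (t < n + n → S (suc t))
      gap-above zero x eq x∉ = x , ≤-refl , ≤-reflexive x≡ , (λ z x≤z z≤x → subst (¬_ ∘ S) (≤-antisym x≤z z≤x) x∉)
                             , λ x< → contradiction x< (<-irrefl x≡)
        where x≡ = trans (sym (+-identityʳ x)) eq
      gap-above (suc m) x eq x∉ with suc x ∈? ball D
      ... | yes x⁺∈ = x , ≤-refl , subst (x ≤_) eq (m≤m+n x (suc m))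
                    , (λ z x≤z z≤x → subst (¬_ ∘ S) (≤-antisym x≤z z≤x) x∉) , λ _ → x⁺∈
      ... | no  x⁺∉ with gap-above m (suc x) (trans (sym (+-suc x m)) eq) x⁺∉
      ...   | t , x<t , t≤ , none , next = t , <⇒≤ x<t , t≤ , none′ , next
        where
        none′ : ∀ z → x ≤ z → z ≤ t → ¬ S z
        none′ z x≤z z≤t with m≤n⇒m<n∨m≡n x≤z
        ... | inj₁ x<z  = none z x<z z≤t
        ... | inj₂ refl = x∉

    -- The maximal gap around a missing vertex would be an interval. A chord leaving it either has
    -- as its other end the ball vertex bordering the gap, impossible since the ball is closed under
    -- `p`, or passes over that vertex, against `ball-avoids`. The gap does not begin at 1, because
    -- the vertex `s` before it is in the ball; this contradicts indecomposability.
    stable-ball-full : ∀ {x} → V x → x ∈ ball D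
    stable-ball-full {x} Vx@(1≤x , x≤2n) with x ∈? ball D
    ... | yes x∈ = x∈
    ... | no  x∉ with gap-below x 1≤x x∉ | gap-above (n + n ∸ x) x (m+[n∸m]≡n x≤2n) x∉
    ...   | s , s<x , s∈ , below | t , x≤t , t≤ , above , next = contradiction
          (proj₁ (indec (suc s) t (s≤s z≤n , ≤-trans s<x x≤t , t≤ , closed)))
          (λ { refl → contradiction (proj₁ (ball-V D s∈)) λ () })
      where
      gap : ∀ z → suc s ≤ z → z ≤ t → ¬ S z
      gap z s<z z≤t with ≤-total z x
      ... | inj₁ z≤x = below z s<z z≤x
      ... | inj₂ x≤z = above z x≤z z≤t
      closed : ∀ z → suc s ≤ z → z ≤ t → suc s ≤ p z × p z ≤ t
      closed z s<z z≤t = ≰⇒> left , ≮⇒≥ right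
        where
        Vz : V z
        Vz = ≤-trans (s≤s z≤n) s<z , ≤-trans z≤t t≤
        z∉ = gap z s<z z≤t
        pz∉ : ¬ S (p z)
        pz∉ pz∈ = z∉ (subst S (invol z Vz) (ball-p D pz∈))
        left : ¬ p z ≤ s
        left pz≤s with m≤n⇒m<n∨m≡n pz≤s
        ... | inj₁ pz<s = ball-avoids Vz z∉ D ≤-refl s∈ (between⇒Inside (inj₂ (refl , refl)) pz<s s<z)
        ... | inj₂ refl = pz∉ s∈
        right : ¬ t < p z
        right t<pz with m≤n⇒m<n∨m≡n t<pz
        ... | inj₁ t⁺<pz = ball-avoids Vz z∉ D ≤-refl (next (<-≤-trans t<pz (proj₂ (range z Vz))))
                             (between⇒Inside (inj₁ (refl , refl)) (s≤s z≤t) t⁺<pz)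
        ... | inj₂ eq    = pz∉ (subst S eq (next (<-≤-trans t<pz (proj₂ (range z Vz)))))

  length-ball : ∀ B → (∀ v → V v → length (neighbours v) ≤ B) → ∀ d → length (ball d) ≤ 2 * suc B ^ d
  length-ball B deg zero    = ≤-refl
  length-ball B deg (suc d) = begin
    length (ball d ++ concatMap neighbours (ball d))           ≡⟨ length-++ (ball d) ⟩
    length (ball d) + length (concatMap neighbours (ball d))   ≤⟨ +-monoʳ-≤ _ (length-concatMap (ball d) (ball-V d)) ⟩
    length (ball d) + length (ball d) * B                      ≡⟨ *-suc (length (ball d)) B ⟨
    length (ball d) * suc B                                    ≤⟨ *-monoˡ-≤ (suc B) (length-ball B deg d) ⟩
    2 * suc B ^ d * suc B                                      ≡⟨ *-assoc 2 (suc B ^ d) (suc B) ⟩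
    2 * (suc B ^ d * suc B)                                    ≡⟨ cong (2 *_) (*-comm (suc B ^ d) (suc B)) ⟩
    2 * suc B ^ suc d                                          ∎
    where
    open ≤-Reasoning
    length-concatMap : ∀ xs → (∀ {v} → v ∈ xs → V v) → length (concatMap neighbours xs) ≤ length xs * B
    length-concatMap []       _  = z≤n
    length-concatMap (x ∷ xs) Vs = ≤-trans (≤-reflexive (length-++ (neighbours x)))
      (+-mono-≤ (deg x (Vs (here refl))) (length-concatMap xs (Vs ∘ there)))

  Layer : ℕ → ℕ → Set
  Layer zero    v = v ∈ ball zero
  Layer (suc d) v = v ∈ ball (suc d) × v ∉ ball d

  Layer⇒ball : ∀ d {v} → Layer d v → v ∈ ball d
  Layer⇒ball zero    = id
  Layer⇒ball (suc d) = proj₁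

  Layer-minimal : ∀ d {v j} → Layer d v → v ∈ ball j → d ≤ j
  Layer-minimal zero    _         _  = z≤n
  Layer-minimal (suc d) (_ , v∉) v∈j = ≰⇒> (λ j≤d → v∉ (ball-mono j≤d v∈j))

  parent : ∀ d {v} → Layer (suc d) v → Σ ℕ λ u → Layer d u × Cross u v
  parent d (v∈ , v∉) with ball-step⁻ d v∈
  ... | inj₁ v∈d = contradiction v∈d v∉
  parent zero    (v∈ , v∉) | inj₂ uc                = uc
  parent (suc d) {v} (v∈ , v∉) | inj₂ (u , u∈ , c) =
    u , (u∈ , λ u∈d → v∉ (ball-step d u∈d (ball-V (suc (suc d)) v∈) c)) , c

  -- Numbering starts at 1 as in pin sequences, with the farthest edge first. The edge `e t` is at
  -- distance `suc d ∸ t`, so the last one, `e (suc d)`, is the root.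
  descent : ∀ d {v} → Layer d v → Σ (ℕ → ℕ) λ e → e 1 ≡ v ×
    (∀ t → 1 ≤ t → t ≤ suc d → Layer (suc d ∸ t) (e t)) ×
    (∀ t → 1 ≤ t → t ≤ d → Cross (e (suc t)) (e t))
  descent zero {v} l = (λ _ → v) , refl , (λ { (suc zero) _ _ → l ; (suc (suc t)) _ (s≤s ()) }) , λ { (suc t) _ () }
  descent (suc d) {v} l with parent d l
  ... | u , lu , c with descent d lu
  ...   | e , refl , layer , cross = e⁺ , refl , layer⁺ , cross⁺
    where
    e⁺ : ℕ → ℕ
    e⁺ (suc (suc t)) = e (suc t)
    e⁺ _             = v
    layer⁺ : ∀ t → 1 ≤ t → t ≤ suc (suc d) → Layer (suc (suc d) ∸ t) (e⁺ t)
    layer⁺ (suc zero)    _ _  = l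
    layer⁺ (suc (suc t)) _ t≤ = layer (suc t) (s≤s z≤n) (s≤s⁻¹ t≤)
    cross⁺ : ∀ t → 1 ≤ t → t ≤ suc d → Cross (e⁺ (suc t)) (e⁺ t)
    cross⁺ (suc zero)    _ _  = c
    cross⁺ (suc (suc t)) _ t≤ = cross (suc t) (s≤s z≤n) (s≤s⁻¹ t≤)

-- Pin sequences from induced paths

-- Both intervals contain `w`. A point `z` to its left lies in the one that attains the minimum of
-- the lower bounds, as that interval reaches as far as `w`; to its right, in the one that attains
-- the maximum.
hull-∪ : ∀ {L H l h w z} → L ≤ w → w ≤ H → l ≤ w → w ≤ h → L ⊓ l ≤ z → z ≤ H ⊔ h →
         (L ≤ z × z ≤ H) ⊎ (l ≤ z × z ≤ h)
hull-∪ {L} {H} {l} {h} {w} {z} L≤w w≤H l≤w w≤h lower upper with ≤-total z w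
... | inj₁ z≤w with ⊓-sel L l
...   | inj₁ eq = inj₁ (subst (_≤ z) eq lower , ≤-trans z≤w w≤H)
...   | inj₂ eq = inj₂ (subst (_≤ z) eq lower , ≤-trans z≤w w≤h)
hull-∪ {L} {H} {l} {h} {w} {z} L≤w w≤H l≤w w≤h lower upper | inj₂ w≤z with ⊔-sel H h
...   | inj₁ eq = inj₁ (≤-trans L≤w w≤z , subst (z ≤_) eq upper)
...   | inj₂ eq = inj₂ (≤-trans l≤w w≤z , subst (z ≤_) eq upper)

module Pins {n : ℕ} {p : ℕ → ℕ} (M : IsMatching n p) where
  open IsMatching M
  open Chords M

  -- What the pin argument retains of a shortest path: distances are forgotten, and it is an induced
  -- path in the crossing graph that ends at the root edge.
  record RootedPath (k : ℕ) (e : ℕ → ℕ) : Set where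
    field
      inV      : ∀ t → 1 ≤ t → t ≤ k → V (e t)
      cross    : ∀ t → 1 ≤ t → suc t ≤ k → Cross (e (suc t)) (e t)
      induced  : ∀ s t → 1 ≤ s → suc s < t → t ≤ k → ¬ Cross (e s) (e t)
      distinct : ∀ s t → 1 ≤ s → s < t → t ≤ k → e t ≢ e s × e t ≢ p (e s)
      root     : 1 ≤ k → e k ≡ 1 ⊎ p (e k) ≡ 1

  module _ {k : ℕ} {e : ℕ → ℕ} (P : RootedPath k e) where
    open RootedPath P

    InRange : ℕ → ℕ → Set
    InRange t z = lo (e t) ≤ z × z ≤ hi (e t)

    shLo-last : ∀ s → shLo p e (suc s) ≤ lo (e (suc s))
    shLo-last zero    = ≤-refl
    shLo-last (suc s) = m⊓n≤n (shLo p e (suc s)) _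

    shHi-last : ∀ s → hi (e (suc s)) ≤ shHi p e (suc s)
    shHi-last zero    = ≤-refl
    shHi-last (suc s) = m≤n⊔m (shHi p e (suc s)) _

    range⇒shadow : ∀ s {t z} → 1 ≤ t → t ≤ s → InRange t z → InShadow p e s z
    range⇒shadow zero    1≤t t≤0 _ = contradiction (≤-trans 1≤t t≤0) λ ()
    range⇒shadow (suc s) 1≤t t≤ (l , h) with m≤n⇒m<n∨m≡n t≤
    ... | inj₂ refl = ≤-trans (shLo-last s) l , ≤-trans h (shHi-last s)
    range⇒shadow (suc zero) 1≤t t≤ lh | inj₁ t<1 = contradiction 1≤t (<⇒≱ t<1)
    range⇒shadow (suc (suc s)) 1≤t t≤ lh | inj₁ t< with range⇒shadow (suc s) 1≤t (s≤s⁻¹ t<) lh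
    ...   | L , H = ≤-trans (m⊓n≤m (shLo p e (suc s)) _) L , ≤-trans H (m≤m⊔n (shHi p e (suc s)) _)

    consecutive-meet : ∀ s → 1 ≤ s → suc s ≤ k → Σ ℕ λ w → InRange s w × InRange (suc s) w
    consecutive-meet s 1≤s s<k with cross s 1≤s s<k
    ... | inj₁ ((l , h) , _) = e s , (m⊓n≤m (e s) _ , m≤m⊔n (e s) _) , (<⇒≤ l , <⇒≤ h)
    ... | inj₂ (_ , (l , h)) = p (e s) , (m⊓n≤n (e s) _ , m≤n⊔m (e s) _) , (<⇒≤ l , <⇒≤ h)

    shadow-step : ∀ s → suc (suc s) ≤ k → ∀ {z} → InShadow p e (suc (suc s)) z →
                  InShadow p e (suc s) z ⊎ InRange (suc (suc s)) z
    shadow-step s s≤k (L , H) with consecutive-meet (suc s) (s≤s z≤n) s≤k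
    ... | w , ws , ws⁺ with range⇒shadow (suc s) (s≤s z≤n) ≤-refl ws
    ...   | Lw , wH = hull-∪ Lw wH (proj₁ ws⁺) (proj₂ ws⁺) L H

    -- Consecutive edges overlap, so the hull of the ranges is no more than their union.
    shadow⇒range : ∀ s → 1 ≤ s → s ≤ k → ∀ {z} → InShadow p e s z → Σ ℕ λ t → 1 ≤ t × t ≤ s × InRange t z
    shadow⇒range (suc s) _ = go s
      where
      go : ∀ s → suc s ≤ k → ∀ {z} → InShadow p e (suc s) z → Σ ℕ λ t → 1 ≤ t × t ≤ suc s × InRange t z
      go zero    _   sh = 1 , ≤-refl , ≤-refl , sh
      go (suc s) s≤k sh with shadow-step s s≤k sh
      ... | inj₂ lh  = suc (suc s) , s≤s z≤n , ≤-refl , lh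
      ... | inj₁ sh′ with go s (<⇒≤ s≤k) sh′
      ...   | t , 1≤t , t≤s , lh = t , 1≤t , m≤n⇒m≤1+n t≤s , lh

    range-closed : ∀ {v x} → V v → V x → x ≢ v → x ≢ p v → ¬ Cross v x →
                   lo v ≤ x → x ≤ hi v → Inside v (p x)
    range-closed {v} {x} Vv Vx x≢v x≢pv no-cross l h =
      decidable-stable (inside? v (p x)) (λ o → no-cross (inj₁ (i , o)))
      where
      x≢end : x ≡ lo v ⊎ x ≡ hi v → ⊥
      x≢end eq = [ x≢v , x≢pv ]′ (end-≡ eq)
      i : Inside v x
      i = ≤∧≢⇒< l (x≢end ∘ inj₁ ∘ sym) , ≤∧≢⇒< h (x≢end ∘ inj₂)

    -- The shadow is a union of ranges, so the given end lies in the range of a single `e t` with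
    -- `t ≤ s`. The path is induced, so `e j` does not cross `e t`, and its other end lies in the
    -- same range.
    shadow-closed : ∀ s j → 1 ≤ s → suc s < j → j ≤ k → InShadow p e s (e j) → InShadow p e s (p (e j))
    shadow-closed s j 1≤s s<j j≤k sh with shadow⇒range s 1≤s (≤-trans (<⇒≤ (<⇒≤ s<j)) j≤k) sh
    ... | t , 1≤t , t≤s , (l , h) = range⇒shadow s 1≤t t≤s (<⇒≤ (proj₁ i) , <⇒≤ (proj₂ i))
      where
      t<j = ≤-<-trans (s≤s t≤s) s<j
      Vj  = inV j (≤-trans 1≤t (<⇒≤ (<⇒≤ t<j))) j≤k
      d   = distinct t j 1≤t (<⇒≤ t<j) j≤k
      i   = range-closed (inV t 1≤t (≤-trans (<⇒≤ (<⇒≤ t<j)) j≤k)) Vj (proj₁ d) (proj₂ d)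
              (induced t j 1≤t t<j j≤k) l h

    shadow-closed⁻ : ∀ s j → 1 ≤ s → suc s < j → j ≤ k → InShadow p e s (p (e j)) → InShadow p e s (e j)
    shadow-closed⁻ s j 1≤s s<j j≤k sh with shadow⇒range s 1≤s (≤-trans (<⇒≤ (<⇒≤ s<j)) j≤k) sh
    ... | t , 1≤t , t≤s , (l , h) = range⇒shadow s 1≤t t≤s
            (subst (lo (e t) ≤_) (invol _ Vj) (<⇒≤ (proj₁ i)) , subst (_≤ hi (e t)) (invol _ Vj) (<⇒≤ (proj₂ i)))
      where
      t<j = ≤-<-trans (s≤s t≤s) s<j
      Vj  = inV j (≤-trans 1≤t (<⇒≤ (<⇒≤ t<j))) j≤k
      Vt  = inV t 1≤t (≤-trans (<⇒≤ (<⇒≤ t<j)) j≤k)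
      d   = distinct t j 1≤t (<⇒≤ t<j) j≤k
      i   = range-closed Vt (range _ Vj)
              (λ eq → proj₂ d (trans (sym (invol _ Vj)) (cong p eq)))
              (λ eq → proj₁ d (p-injective Vj Vt eq))
              (induced t j 1≤t t<j j≤k ∘ Cross-pʳ⁻ Vj) l h

    -- Walking down from the root, which is not inside the shadow because of its endpoint 1: if
    -- e (suc j) is not inside the shadow then it avoids it, so e j, which crosses it, is not inside either.
    not-inside-shadow : ∀ s → 1 ≤ s → ∀ m j → s < j → j + m ≡ k →
                        ¬ (InShadow p e s (e j) × InShadow p e s (p (e j)))
    not-inside-shadow s 1≤s zero j s<j eq (sh , sh′) = 1∉ (root (≤-trans 1≤s s≤k))
      where
      j≡k = trans (sym (+-identityʳ j)) eq
      s<k = subst (s <_) j≡k s<j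
      s≤k = <⇒≤ s<k
      starts-at-1 : ∀ {t} → t < k → 1 ≤ t → 1 ≡ e t ⊎ 1 ≡ p (e t) → e k ≡ 1 ⊎ p (e k) ≡ 1 → ⊥
      starts-at-1 {t} t<k 1≤t a b with distinct t k 1≤t t<k ≤-refl | a | b
      ... | d , d′ | inj₁ x | inj₁ y = d (trans y x)
      ... | d , d′ | inj₂ x | inj₁ y = d′ (trans y x)
      ... | d , d′ | inj₁ x | inj₂ y = d′ (trans (sym (invol _ (inV k (≤-trans 1≤t (<⇒≤ t<k)) ≤-refl))) (cong p (trans y x)))
      ... | d , d′ | inj₂ x | inj₂ y = d (p-injective (inV k (≤-trans 1≤t (<⇒≤ t<k)) ≤-refl) (inV t 1≤t (<⇒≤ t<k)) (trans y x))
      1-shadow : e k ≡ 1 ⊎ p (e k) ≡ 1 → InShadow p e s 1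
      1-shadow (inj₁ r) = subst (InShadow p e s) (trans (cong e j≡k) r) sh
      1-shadow (inj₂ r) = subst (InShadow p e s) (trans (cong (p ∘ e) j≡k) r) sh′
      1∉ : e k ≡ 1 ⊎ p (e k) ≡ 1 → ⊥
      -- Some `e t` with `t ≤ s` has 1 in its range; no vertex is smaller, so 1 is an endpoint of
      -- `e t`. Then `e t` is the root edge, although it differs from `e k`.
      1∉ r with shadow⇒range s 1≤s s≤k (1-shadow r)
      ... | t , 1≤t , t≤s , (l , _) = starts-at-1 t<k 1≤t
              (end-≡ (inj₁ (≤-antisym (⊓-glb (proj₁ Vt) (proj₁ (range _ Vt))) l))) r
        where
        t<k = ≤-<-trans t≤s s<k
        Vt  = inV t 1≤t (<⇒≤ t<k)
    not-inside-shadow s 1≤s (suc m) j s<j eq (sh , sh′) =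
      convex-separates convex e⁺∉ pe⁺∉ sh sh′ (cross j (≤-trans 1≤s (<⇒≤ s<j)) j<k)
      where
      eq′ = trans (sym (+-suc j m)) eq
      j<k : suc j ≤ k
      j<k = subst (suc j ≤_) eq′ (m≤m+n (suc j) m)
      later = not-inside-shadow s 1≤s m (suc j) (m<n⇒m<1+n s<j) eq′
      e⁺∉ : ¬ InShadow p e s (e (suc j))
      e⁺∉ z = later (z , shadow-closed s (suc j) 1≤s (s<s s<j) j<k z)
      pe⁺∉ : ¬ InShadow p e s (p (e (suc j)))
      pe⁺∉ z = later (shadow-closed⁻ s (suc j) 1≤s (s<s s<j) j<k z , z)
      convex : ∀ {x y z} → InShadow p e s x → InShadow p e s z → x ≤ y → y ≤ z → InShadow p e s y
      convex (L , _) (_ , H) x≤y y≤z = ≤-trans L x≤y , ≤-trans y≤z H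

    -- Crossing the preceding edge puts one endpoint into the shadow; `not-inside-shadow` keeps the
    -- other one out.
    splits : ∀ i → 2 ≤ i → i ≤ k → Splits p e i (i ∸ 1)
    splits (suc zero)        (s≤s ()) _
    splits (suc i@(suc _)) _ i<k with Cross-sym (inV (suc i) (s≤s z≤n) i<k) (inV i (s≤s z≤n) (<⇒≤ i<k)) (cross i (s≤s z≤n) i<k)
    ... | inj₁ ((l , h) , _) = inj₁ (sh , λ sh′ → not-both (sh , sh′))
      where
      not-both = not-inside-shadow i (s≤s z≤n) (k ∸ suc i) (suc i) ≤-refl (m+[n∸m]≡n i<k)
      sh = range⇒shadow i (s≤s z≤n) ≤-refl (<⇒≤ l , <⇒≤ h)
    ... | inj₂ (_ , (l , h)) = inj₂ ((λ sh → not-both (sh , sh′)) , sh′)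
      where
      not-both = not-inside-shadow i (s≤s z≤n) (k ∸ suc i) (suc i) ≤-refl (m+[n∸m]≡n i<k)
      sh′ = range⇒shadow i (s≤s z≤n) ≤-refl (<⇒≤ l , <⇒≤ h)

    proper : ∀ i → 3 ≤ i → i ≤ k → ¬ Splits p e i (i ∸ 2)
    proper (suc zero)          (s≤s ()) _
    proper (suc (suc zero))    (s≤s (s≤s ())) _
    proper i@(suc (suc s@(suc _))) _ i≤k (inj₁ (sh , o)) = o (shadow-closed s i (s≤s z≤n) ≤-refl i≤k sh)
    proper i@(suc (suc s@(suc _))) _ i≤k (inj₂ (o , sh)) = o (shadow-closed⁻ s i (s≤s z≤n) ≤-refl i≤k sh)

-- Restriction of a matching to the edges of a path

module Restriction {n : ℕ} {p : ℕ → ℕ} (M : IsMatching n p)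
                   {k : ℕ} {e : ℕ → ℕ} (P : Pins.RootedPath M k e) where
  open IsMatching M
  open Chords M
  open Pins M
  open RootedPath P

  endpoints : ℕ → List ℕ
  endpoints zero    = []
  endpoints (suc t) = e (suc t) ∷ p (e (suc t)) ∷ endpoints t

  length-endpoints : ∀ s → length (endpoints s) ≡ s + s
  length-endpoints zero    = refl
  length-endpoints (suc s) = cong suc (trans (cong suc (length-endpoints s)) (sym (+-suc s s)))

  ∈-endpoints : ∀ s {t} → 1 ≤ t → t ≤ s → e t ∈ endpoints s × p (e t) ∈ endpoints s
  ∈-endpoints zero    1≤t t≤0 = contradiction (≤-trans 1≤t t≤0) λ ()
  ∈-endpoints (suc s) 1≤t t≤s with m≤n⇒m<n∨m≡n t≤s
  ... | inj₂ refl = here refl , there (here refl)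
  ... | inj₁ t<   with ∈-endpoints s 1≤t (s≤s⁻¹ t<)
  ...   | a , b = there (there a) , there (there b)

  ∈-endpoints⁻ : ∀ s {x} → x ∈ endpoints s → Σ ℕ λ t → 1 ≤ t × t ≤ s × (x ≡ e t ⊎ x ≡ p (e t))
  ∈-endpoints⁻ (suc s) (here eq)         = suc s , s≤s z≤n , ≤-refl , inj₁ eq
  ∈-endpoints⁻ (suc s) (there (here eq)) = suc s , s≤s z≤n , ≤-refl , inj₂ eq
  ∈-endpoints⁻ (suc s) (there (there x∈)) with ∈-endpoints⁻ s x∈
  ... | t , 1≤t , t≤s , eq = t , 1≤t , m≤n⇒m≤1+n t≤s , eq

  endpoint-V : ∀ {x t} → 1 ≤ t → t ≤ k → x ≡ e t ⊎ x ≡ p (e t) → V x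
  endpoint-V 1≤t t≤k (inj₁ refl) = inV _ 1≤t t≤k
  endpoint-V 1≤t t≤k (inj₂ refl) = range _ (inV _ 1≤t t≤k)

  endpoints-Unique : ∀ s → s ≤ k → Unique (endpoints s)
  endpoints-Unique zero    _   = []
  endpoints-Unique (suc s) s<k =
    ((noFix _ Vs ∘ sym) ∷ All.tabulate new) ∷ All.tabulate new-p ∷ endpoints-Unique s (<⇒≤ s<k)
    where
    Vs = inV (suc s) (s≤s z≤n) s<k
    new : ∀ {x} → x ∈ endpoints s → e (suc s) ≢ x
    new x∈ eq with ∈-endpoints⁻ s x∈
    ... | t , 1≤t , t≤s , inj₁ refl = proj₁ (distinct t (suc s) 1≤t (s≤s t≤s) s<k) eq
    ... | t , 1≤t , t≤s , inj₂ refl = proj₂ (distinct t (suc s) 1≤t (s≤s t≤s) s<k) eq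
    new-p : ∀ {x} → x ∈ endpoints s → p (e (suc s)) ≢ x
    new-p x∈ eq with ∈-endpoints⁻ s x∈
    ... | t , 1≤t , t≤s , inj₁ refl = proj₂ (distinct t (suc s) 1≤t (s≤s t≤s) s<k)
            (trans (sym (invol _ Vs)) (cong p eq))
    ... | t , 1≤t , t≤s , inj₂ refl = proj₁ (distinct t (suc s) 1≤t (s≤s t≤s) s<k)
            (p-injective Vs (inV t 1≤t (≤-trans t≤s (<⇒≤ s<k))) eq)

  kept : List ℕ
  kept = filter (_∈? endpoints k) vertices

  ∈-kept : ∀ {x} → x ∈ endpoints k → x ∈ kept
  ∈-kept x∈ with ∈-endpoints⁻ k x∈
  ... | t , 1≤t , t≤k , eq = ∈-filter⁺ (_∈? endpoints k) (∈-vertices (endpoint-V 1≤t t≤k eq)) x∈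

  ∈-kept⁻ : ∀ {x} → x ∈ kept → V x × x ∈ endpoints k
  ∈-kept⁻ x∈ with ∈-filter⁻ (_∈? endpoints k) {xs = vertices} x∈
  ... | x∈V , x∈e = ∈-vertices⁻ x∈V , x∈e

  kept-p : ∀ {x} → x ∈ kept → p x ∈ kept
  kept-p x∈ with ∈-endpoints⁻ k (proj₂ (∈-kept⁻ x∈))
  ... | t , 1≤t , t≤k , inj₁ refl = ∈-kept (proj₂ (∈-endpoints k 1≤t t≤k))
  ... | t , 1≤t , t≤k , inj₂ refl = subst (_∈ kept) (sym (invol _ (inV t 1≤t t≤k))) (∈-kept (proj₁ (∈-endpoints k 1≤t t≤k)))

  kept-sorted : AllPairs _<_ kept
  kept-sorted = AllPairsₚ.filter⁺ (_∈? endpoints k) vertices-sorted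

  -- `kept` and `endpoints k` are duplicate-free and contain each other: one is the sorted form of
  -- the other.
  length-kept : length kept ≡ k + k
  length-kept = trans (≤-antisym
    (Unique-⊆⇒length≤ (<-sorted⇒Unique kept-sorted) (proj₂ ∘ ∈-kept⁻))
    (Unique-⊆⇒length≤ (endpoints-Unique k ≤-refl) ∈-kept)) (length-endpoints k)

  f : ℕ → ℕ
  f i = nth (n + n) kept (pred i)

  -- Monotonicity on all of ℕ, beyond the `2k` vertices too, is what lets `f` distribute over `⊓`
  -- and `⊔`. Thus `f` carries the shadow bounds of `q` to those of `p`, and splitting can be read
  -- off on either side.
  f-mono : ∀ {i j} → i ≤ j → f i ≤ f j
  f-mono i≤j = nth-mono (All.tabulate (proj₂ ∘ proj₁ ∘ ∈-kept⁻)) kept-sorted (pred-mono-≤ i≤j)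

  f-strict : ∀ i j → InV k i → InV k j → i < j → f i < f j
  f-strict (suc i) (suc j) _ (_ , j≤) i<j =
    nth-AllPairs (n + n) kept-sorted (s<s⁻¹ i<j) (subst (j <_) (sym length-kept) j≤)

  f-∈ : ∀ {i} → InV k i → f i ∈ kept
  f-∈ {suc i} (_ , i≤) = nth-∈ (n + n) kept (subst (i <_) (sym length-kept) i≤)

  f-injective : ∀ {i j} → InV k i → InV k j → f i ≡ f j → i ≡ j
  f-injective {i} {j} Vi Vj eq with <-cmp i j
  ... | tri< i<j _ _ = contradiction (f-strict i j Vi Vj i<j) (<-irrefl eq)
  ... | tri≈ _ i≡j _ = i≡j
  ... | tri> _ _ j<i = contradiction (f-strict j i Vj Vi j<i) (<-irrefl (sym eq))

  f-reflects-≤ : ∀ {i j} → InV k i → InV k j → f i ≤ f j → i ≤ j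
  f-reflects-≤ {i} {j} Vi Vj le = ≮⇒≥ (λ j<i → <⇒≱ (f-strict j i Vj Vi j<i) le)

  rank : ℕ → ℕ
  rank x = suc (position x kept)

  rank-V : ∀ {x} → x ∈ kept → InV k (rank x)
  rank-V {x} x∈ = s≤s z≤n , subst (position x kept <_) length-kept (position-< x∈)

  f-rank : ∀ {x} → x ∈ kept → f (rank x) ≡ x
  f-rank = nth-position (n + n)

  q e′ : ℕ → ℕ
  q i  = rank (p (f i))
  e′ t = rank (e t)

  f-q : ∀ {i} → InV k i → f (q i) ≡ p (f i)
  f-q Vi = f-rank (kept-p (f-∈ Vi))

  q-V : ∀ {i} → InV k i → InV k (q i)
  q-V Vi = rank-V (kept-p (f-∈ Vi))

  q-matching : IsMatching k q
  q-matching = record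
    { range = λ _ → q-V
    ; noFix = λ i Vi eq → noFix (f i) (f-V Vi) (trans (sym (f-q Vi)) (cong f eq))
    ; invol = λ i Vi → f-injective (q-V (q-V Vi)) Vi
        (trans (f-q (q-V Vi)) (trans (cong p (f-q Vi)) (invol _ (f-V Vi))))
    }
    where
    f-V : ∀ {i} → InV k i → V (f i)
    f-V = proj₁ ∘ ∈-kept⁻ ∘ f-∈

  q-contained : Contains n p k q
  q-contained = f , (λ _ → proj₁ ∘ ∈-kept⁻ ∘ f-∈) , f-strict , λ _ → f-q

  e∈ : ∀ {t} → 1 ≤ t → t ≤ k → e t ∈ kept
  e∈ 1≤t t≤k = ∈-kept (proj₁ (∈-endpoints k 1≤t t≤k))

  e′-V : ∀ {t} → 1 ≤ t → t ≤ k → InV k (e′ t)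
  e′-V 1≤t t≤k = rank-V (e∈ 1≤t t≤k)

  f-e′ : ∀ {t} → 1 ≤ t → t ≤ k → f (e′ t) ≡ e t
  f-e′ 1≤t t≤k = f-rank (e∈ 1≤t t≤k)

  f-qe′ : ∀ {t} → 1 ≤ t → t ≤ k → f (q (e′ t)) ≡ p (e t)
  f-qe′ 1≤t t≤k = trans (f-q (e′-V 1≤t t≤k)) (cong p (f-e′ 1≤t t≤k))

  ordering : IsEdgeOrdering k q e′
  ordering = (λ t → e′-V) , distinct′ , cover
    where
    distinct′ : ∀ t s → 1 ≤ t → t ≤ k → 1 ≤ s → s ≤ k → t ≢ s → e′ s ≢ e′ t × e′ s ≢ q (e′ t)
    distinct′ t s 1≤t t≤k 1≤s s≤k t≢s =
      (λ eq → proj₁ apart (trans (sym (f-e′ 1≤s s≤k)) (trans (cong f eq) (f-e′ 1≤t t≤k)))) ,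
      (λ eq → proj₂ apart (trans (sym (f-e′ 1≤s s≤k)) (trans (cong f eq) (f-qe′ 1≤t t≤k))))
      where
      apart : e s ≢ e t × e s ≢ p (e t)
      apart with <-cmp t s
      ... | tri< t<s _ _ = distinct t s 1≤t t<s s≤k
      ... | tri≈ _ t≡s _ = contradiction t≡s t≢s
      ... | tri> _ _ s<t with distinct s t 1≤s s<t t≤k
      ...   | d , d′ = d ∘ sym , λ eq → d′ (trans (sym (invol _ (inV t 1≤t t≤k))) (cong p (sym eq)))
    cover : ∀ v → InV k v → Σ ℕ λ t → 1 ≤ t × t ≤ k × (v ≡ e′ t ⊎ v ≡ q (e′ t))
    cover v Vv with ∈-endpoints⁻ k (proj₂ (∈-kept⁻ (f-∈ Vv)))
    ... | t , 1≤t , t≤k , inj₁ eq = t , 1≤t , t≤k , inj₁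
            (f-injective Vv (e′-V 1≤t t≤k) (trans eq (sym (f-e′ 1≤t t≤k))))
    ... | t , 1≤t , t≤k , inj₂ eq = t , 1≤t , t≤k , inj₂
            (f-injective Vv (q-V (e′-V 1≤t t≤k)) (trans eq (sym (f-qe′ 1≤t t≤k))))

  ⊓-V : ∀ {a b} → InV k a → InV k b → InV k (a ⊓ b)
  ⊓-V {a} {b} (la , ha) (lb , hb) = ⊓-glb la lb , ≤-trans (m⊓n≤m a b) ha

  ⊔-V : ∀ {a b} → InV k a → InV k b → InV k (a ⊔ b)
  ⊔-V {a} {b} (la , ha) (lb , hb) = ≤-trans la (m≤m⊔n a b) , ⊔-lub ha hb

  shLo-V : ∀ s → suc s ≤ k → InV k (shLo q e′ (suc s))
  shLo-V zero    s≤k = ⊓-V (e′-V ≤-refl s≤k) (q-V (e′-V ≤-refl s≤k))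
  shLo-V (suc s) s≤k = ⊓-V (shLo-V s (<⇒≤ s≤k)) (⊓-V (e′-V (s≤s z≤n) s≤k) (q-V (e′-V (s≤s z≤n) s≤k)))

  shHi-V : ∀ s → suc s ≤ k → InV k (shHi q e′ (suc s))
  shHi-V zero    s≤k = ⊔-V (e′-V ≤-refl s≤k) (q-V (e′-V ≤-refl s≤k))
  shHi-V (suc s) s≤k = ⊔-V (shHi-V s (<⇒≤ s≤k)) (⊔-V (e′-V (s≤s z≤n) s≤k) (q-V (e′-V (s≤s z≤n) s≤k)))

  f-lo : ∀ {t} → 1 ≤ t → t ≤ k → f (e′ t ⊓ q (e′ t)) ≡ lo (e t)
  f-lo {t} 1≤t t≤k = trans (mono-≤-distrib-⊓ f-mono (e′ t) (q (e′ t))) (cong₂ _⊓_ (f-e′ 1≤t t≤k) (f-qe′ 1≤t t≤k))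

  f-hi : ∀ {t} → 1 ≤ t → t ≤ k → f (e′ t ⊔ q (e′ t)) ≡ hi (e t)
  f-hi {t} 1≤t t≤k = trans (mono-≤-distrib-⊔ f-mono (e′ t) (q (e′ t))) (cong₂ _⊔_ (f-e′ 1≤t t≤k) (f-qe′ 1≤t t≤k))

  f-shLo : ∀ s → suc s ≤ k → f (shLo q e′ (suc s)) ≡ shLo p e (suc s)
  f-shLo zero    s≤k = f-lo ≤-refl s≤k
  f-shLo (suc s) s≤k = trans (mono-≤-distrib-⊓ f-mono (shLo q e′ (suc s)) (e′ (suc (suc s)) ⊓ q (e′ (suc (suc s)))))
    (cong₂ _⊓_ (f-shLo s (<⇒≤ s≤k)) (f-lo (s≤s z≤n) s≤k))

  f-shHi : ∀ s → suc s ≤ k → f (shHi q e′ (suc s)) ≡ shHi p e (suc s)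
  f-shHi zero    s≤k = f-hi ≤-refl s≤k
  f-shHi (suc s) s≤k = trans (mono-≤-distrib-⊔ f-mono (shHi q e′ (suc s)) (e′ (suc (suc s)) ⊔ q (e′ (suc (suc s)))))
    (cong₂ _⊔_ (f-shHi s (<⇒≤ s≤k)) (f-hi (s≤s z≤n) s≤k))

  f-shadow : ∀ s {z x} → suc s ≤ k → f z ≡ x → InShadow q e′ (suc s) z → InShadow p e (suc s) x
  f-shadow s {z} s≤k refl (l , h) = subst (_≤ f z) (f-shLo s s≤k) (f-mono l) , subst (f z ≤_) (f-shHi s s≤k) (f-mono h)

  f-shadow⁻ : ∀ s {z x} → suc s ≤ k → InV k z → f z ≡ x → InShadow p e (suc s) x → InShadow q e′ (suc s) z
  f-shadow⁻ s {z} s≤k Vz refl (l , h) =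
    f-reflects-≤ (shLo-V s s≤k) Vz (subst (_≤ f z) (sym (f-shLo s s≤k)) l) ,
    f-reflects-≤ Vz (shHi-V s s≤k) (subst (f z ≤_) (sym (f-shHi s s≤k)) h)

  f-splits : ∀ t s → 1 ≤ t → t ≤ k → suc s ≤ k → Splits q e′ t (suc s) → Splits p e t (suc s)
  f-splits t s 1≤t t≤k s≤k (inj₁ (i , o)) = inj₁
    (f-shadow s s≤k (f-e′ 1≤t t≤k) i , o ∘ f-shadow⁻ s s≤k (q-V (e′-V 1≤t t≤k)) (f-qe′ 1≤t t≤k))
  f-splits t s 1≤t t≤k s≤k (inj₂ (o , i)) = inj₂
    (o ∘ f-shadow⁻ s s≤k (e′-V 1≤t t≤k) (f-e′ 1≤t t≤k) , f-shadow s s≤k (f-qe′ 1≤t t≤k) i)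

  f-splits⁻ : ∀ t s → 1 ≤ t → t ≤ k → suc s ≤ k → Splits p e t (suc s) → Splits q e′ t (suc s)
  f-splits⁻ t s 1≤t t≤k s≤k (inj₁ (i , o)) = inj₁
    (f-shadow⁻ s s≤k (e′-V 1≤t t≤k) (f-e′ 1≤t t≤k) i , o ∘ f-shadow s s≤k (f-qe′ 1≤t t≤k))
  f-splits⁻ t s 1≤t t≤k s≤k (inj₂ (o , i)) = inj₂
    (o ∘ f-shadow s s≤k (f-e′ 1≤t t≤k) , f-shadow⁻ s s≤k (q-V (e′-V 1≤t t≤k)) (f-qe′ 1≤t t≤k) i)

  q-proper : IsProperPinSeq k q
  q-proper = e′ , ordering , splits′ , proper′
    where
    splits′ : ∀ i → 2 ≤ i → i ≤ k → Splits q e′ i (i ∸ 1)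
    splits′ (suc zero)    (s≤s ()) _
    splits′ i@(suc (suc s)) 2≤i i≤k = f-splits⁻ i s (s≤s z≤n) i≤k (<⇒≤ i≤k) (splits P i 2≤i i≤k)
    proper′ : ∀ i → 3 ≤ i → i ≤ k → ¬ Splits q e′ i (i ∸ 2)
    proper′ (suc zero)       (s≤s ()) _
    proper′ (suc (suc zero)) (s≤s (s≤s ())) _
    proper′ i@(suc (suc (suc s))) 3≤i i≤k = proper P i 3≤i i≤k ∘ f-splits i s (s≤s z≤n) i≤k (<⇒≤ (<⇒≤ i≤k))

-- Interleavings and broken nestings

if-yes : ∀ {b} {x y : ℕ} → T b → (if b then x else y) ≡ x
if-yes {true} _ = refl

if-no : ∀ {b} {x y : ℕ} → ¬ T b → (if b then x else y) ≡ y
if-no {true}  f = ⊥-elim (f _)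
if-no {false} _ = refl

module Patterns {n : ℕ} {p : ℕ → ℕ} (M : IsMatching n p) where
  open IsMatching M
  open Chords M

  -- α and β list the vertices of p playing the roles of 1, …, k and k + 1, …, 2k; c separates the two rows.
  two-rows : ∀ {k q} (σ α β : ℕ → ℕ) (c : ℕ) →
    (∀ i → 1 ≤ i → i ≤ k → 1 ≤ σ i × σ i ≤ k) →
    (∀ i → 1 ≤ i → i ≤ k → σ (σ i) ≡ i) →
    (∀ i → 1 ≤ i → i ≤ k → q i ≡ k + σ i × q (k + i) ≡ σ i) →
    (∀ i → 1 ≤ i → i ≤ k → V (α i) × p (α i) ≡ β (σ i)) →
    (∀ i j → 1 ≤ i → i < j → j ≤ k → α i < α j) →
    (∀ i j → 1 ≤ i → i < j → j ≤ k → β i < β j) →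
    (∀ i → 1 ≤ i → i ≤ k → α i < c × c ≤ β i) →
    Contains n p k q
  two-rows {k} {q} σ α β c σ-range σσ q-σ edge α-inc β-inc sep = f , f-V , f-inc , f-q
    where
    f : ℕ → ℕ
    f i = if i ≤ᵇ k then α i else β (i ∸ k)
    f-low : ∀ {i} → i ≤ k → f i ≡ α i
    f-low i≤k = if-yes (≤⇒≤ᵇ i≤k)
    f-high : ∀ {j} → 1 ≤ j → f (k + j) ≡ β j
    f-high {j} 1≤j = trans (if-no (λ t → <⇒≱ (m<m+n k 1≤j) (≤ᵇ⇒≤ (k + j) k t))) (cong β (m+n∸m≡n k j))
    Row : ℕ → Set
    Row i = i ≤ k ⊎ Σ ℕ λ j → k + j ≡ i × 1 ≤ j × j ≤ k
    row : ∀ i → i ≤ k + k → Row i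
    row i i≤ with i ≤? k
    ... | yes i≤k = inj₁ i≤k
    ... | no  i≰k = inj₂ (i ∸ k , m+[n∸m]≡n (<⇒≤ k<i) , m<n⇒0<n∸m k<i , m≤n+o⇒m∸n≤o i k i≤)
      where k<i = ≰⇒> i≰k
    β-edge : ∀ j → 1 ≤ j → j ≤ k → V (β j) × p (β j) ≡ α (σ j)
    β-edge j 1≤j j≤k with σ-range j 1≤j j≤k
    ... | 1≤σ , σ≤k with edge (σ j) 1≤σ σ≤k
    ...   | Vα , eq = subst V eq′ (range _ Vα) , trans (cong p (sym eq′)) (invol _ Vα)
      where eq′ = trans eq (cong β (σσ j 1≤j j≤k))
    f-V : ∀ i → InV k i → V (f i)
    f-V i (1≤i , i≤) with row i i≤
    ... | inj₁ i≤k                   = subst V (sym (f-low i≤k)) (proj₁ (edge i 1≤i i≤k))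
    ... | inj₂ (j , refl , 1≤j , j≤) = subst V (sym (f-high 1≤j)) (proj₁ (β-edge j 1≤j j≤))
    f-inc : ∀ i j → InV k i → InV k j → i < j → f i < f j
    f-inc i j (1≤i , i≤) (_ , j≤) i<j with row i i≤ | row j j≤
    ... | inj₁ i≤k | inj₁ j≤k = subst₂ _<_ (sym (f-low i≤k)) (sym (f-low j≤k)) (α-inc i j 1≤i i<j j≤k)
    ... | inj₁ i≤k | inj₂ (j′ , refl , 1≤j′ , j′≤) = subst₂ _<_ (sym (f-low i≤k)) (sym (f-high 1≤j′))
            (<-≤-trans (proj₁ (sep i 1≤i i≤k)) (proj₂ (sep j′ 1≤j′ j′≤)))
    ... | inj₂ (i′ , refl , _ , _) | inj₁ j≤k = contradiction j≤k (<⇒≱ (≤-<-trans (m≤m+n k i′) i<j))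
    ... | inj₂ (i′ , refl , 1≤i′ , i′≤) | inj₂ (j′ , refl , 1≤j′ , j′≤) =
            subst₂ _<_ (sym (f-high 1≤i′)) (sym (f-high 1≤j′)) (β-inc i′ j′ 1≤i′ (+-cancelˡ-< k i′ j′ i<j) j′≤)
    f-q : ∀ i → InV k i → f (q i) ≡ p (f i)
    f-q i (1≤i , i≤) with row i i≤
    ... | inj₁ i≤k = trans (cong f (proj₁ (q-σ i 1≤i i≤k))) (trans (f-high (proj₁ (σ-range i 1≤i i≤k)))
            (trans (sym (proj₂ (edge i 1≤i i≤k))) (cong p (sym (f-low i≤k)))))
    ... | inj₂ (j , refl , 1≤j , j≤) = trans (cong f (proj₂ (q-σ j 1≤j j≤))) (trans (f-low (proj₂ (σ-range j 1≤j j≤)))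
            (trans (sym (proj₂ (β-edge j 1≤j j≤))) (cong p (sym (f-high 1≤j)))))

  -- Each of the three patterns joins the `i`-th vertex of its first half to the `σ i`-th of its
  -- second half, for an involution `σ` of `1, …, k`. Here `σ` is the identity.
  contains-interleaving : ∀ {k} (α β : ℕ → ℕ) (c : ℕ) →
    (∀ {i} → i < k → V (α i) × p (α i) ≡ β i × α i < c × c ≤ β i) →
    (∀ {i j} → i < j → j < k → α i < α j × β i < β j) →
    Contains n p k (interleaving k)
  contains-interleaving {k} α β c edge inc = two-rows id (α ∘ pred) (β ∘ pred) c
    (λ i 1≤i i≤k → 1≤i , i≤k)
    (λ i _ _ → refl)
    (λ i 1≤i i≤k → trans (if-yes (≤⇒≤ᵇ i≤k)) (+-comm i k)
                 , trans (if-no (λ t → <⇒≱ (m<m+n k 1≤i) (≤ᵇ⇒≤ (k + i) k t))) (m+n∸m≡n k i))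
    (λ { (suc i) _ i<k → proj₁ (edge i<k) , proj₁ (proj₂ (edge i<k)) })
    (λ { (suc i) (suc j) _ i<j j<k → proj₁ (inc (s<s⁻¹ i<j) j<k) })
    (λ { (suc i) (suc j) _ i<j j<k → proj₂ (inc (s<s⁻¹ i<j) j<k) })
    (λ { (suc i) _ i<k → proj₂ (proj₂ (edge i<k)) })

  -- The edge at `a` breaks the nesting and comes first in both rows. The nested edges follow in the
  -- order of `g` in the first row and in reverse order in the second, so `σ` fixes 1 and reverses
  -- `2, …, k`. The second row begins at `p a`, which therefore separates the rows.
  contains-leftBroken : ∀ {k′} (a : ℕ) (g : ℕ → ℕ) → V a → a < p a →
    (∀ {i} → i < k′ → V (g i) × a < g i × g i < p a × p a < p (g i)) →
    (∀ {i j} → i < j → j < k′ → g i < g j × p (g j) < p (g i)) →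
    Contains n p (suc k′) (leftBroken (suc k′))
  contains-leftBroken {k′} a g Va a<b nest down =
    two-rows σ α β (p a) σ-range σσ q-σ edge α-inc β-inc sep
    where
    k = suc k′
    σ α β : ℕ → ℕ
    σ (suc (suc m)) = k ∸ m
    σ _             = 1
    α (suc (suc m)) = g m
    α _             = a
    β j@(suc (suc _)) = p (g (k ∸ j))
    β _               = p a
    σ-≥2 : ∀ {i} → 2 ≤ i → σ i ≡ suc (suc k) ∸ i
    σ-≥2 {suc (suc _)} _ = refl
    σ-≥2 {suc zero} (s≤s ())
    β-≥2 : ∀ {j} → 2 ≤ j → β j ≡ p (g (k ∸ j))
    β-≥2 {suc (suc _)} _ = refl
    β-≥2 {suc zero} (s≤s ())
    2≤k∸m : ∀ {m} → suc (suc m) ≤ k → 2 ≤ k ∸ m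
    2≤k∸m m≤k = m+n≤o⇒m≤o∸n 2 m≤k
    m≤k : ∀ {m} → suc (suc m) ≤ k → m ≤ k
    m≤k = <⇒≤ ∘ <⇒≤
    σ-range : ∀ i → 1 ≤ i → i ≤ k → 1 ≤ σ i × σ i ≤ k
    σ-range (suc zero)    _ _   = ≤-refl , s≤s z≤n
    σ-range (suc (suc m)) _ i≤k = <⇒≤ (2≤k∸m i≤k) , m∸n≤m k m
    σσ : ∀ i → 1 ≤ i → i ≤ k → σ (σ i) ≡ i
    σσ (suc zero)    _ _   = refl
    σσ (suc (suc m)) _ i≤k = trans (σ-≥2 (2≤k∸m i≤k))
      (trans (+-∸-assoc 2 (m∸n≤m k m)) (cong (suc ∘ suc) (m∸[m∸n]≡n (m≤k i≤k))))
    q-σ : ∀ i → 1 ≤ i → i ≤ k → leftBroken k i ≡ k + σ i × leftBroken k (k + i) ≡ σ i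
    q-σ (suc zero) _ _ = sym (+-comm k 1)
      , trans (if-no (λ t → m+1+n≢0 k′ (suc-injective (≡ᵇ⇒≡ (k + 1) 1 t)))) (if-yes (≡⇒≡ᵇ (k + 1) (suc k) (+-comm k 1)))
    q-σ (suc (suc m)) _ i≤k = trans (if-no (<⇒≢ i≤k ∘ suc-injective ∘ ≡ᵇ⇒≡ (suc (suc m)) (suc k))) (+-∸-assoc k (m≤k i≤k))
      , trans (if-no (λ t → m+1+n≢0 k′ (suc-injective (≡ᵇ⇒≡ (k + suc (suc m)) 1 t))))
          (trans (if-no (λ t → m+1+n≢m (suc k) (trans (sym (+-suc k (suc m))) (≡ᵇ⇒≡ (k + suc (suc m)) (suc k) t))))
            (trans (cong (suc (suc (k + k)) ∸_) (trans (+-suc k (suc m)) (cong suc (+-suc k m)))) ([m+n]∸[m+o]≡n∸o k k m)))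
    edge : ∀ i → 1 ≤ i → i ≤ k → V (α i) × p (α i) ≡ β (σ i)
    edge (suc zero)    _ _   = Va , refl
    edge (suc (suc m)) _ i≤k = proj₁ (nest (s≤s⁻¹ i≤k))
      , sym (trans (β-≥2 (2≤k∸m i≤k)) (cong (p ∘ g) (m∸[m∸n]≡n (m≤k i≤k))))
    α-inc : ∀ i j → 1 ≤ i → i < j → j ≤ k → α i < α j
    α-inc (suc zero)    (suc (suc m)) _ _   j≤k = proj₁ (proj₂ (nest (s≤s⁻¹ j≤k)))
    α-inc (suc (suc l)) (suc (suc m)) _ i<j j≤k = proj₁ (down (s<s⁻¹ (s<s⁻¹ i<j)) (s≤s⁻¹ j≤k))
    α-inc (suc _)       (suc zero)    _ (s≤s ()) _
    k∸ : ∀ {m} → suc (suc m) ≤ k → k ∸ suc (suc m) < k′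
    k∸ {m} (s≤s m<k′) = ∸-monoʳ-< (s≤s z≤n) m<k′
    β-inc : ∀ i j → 1 ≤ i → i < j → j ≤ k → β i < β j
    β-inc (suc zero)    (suc (suc m)) _ _   j≤k = proj₂ (proj₂ (proj₂ (nest (k∸ j≤k))))
    β-inc (suc (suc l)) (suc (suc m)) _ i<j j≤k = proj₂ (down (∸-monoʳ-< i<j j≤k) (k∸ (≤-trans (<⇒≤ i<j) j≤k)))
    β-inc (suc _)       (suc zero)    _ (s≤s ()) _
    sep : ∀ i → 1 ≤ i → i ≤ k → α i < p a × p a ≤ β i
    sep (suc zero)    _ _   = a<b , ≤-refl
    sep (suc (suc m)) _ i≤k = proj₁ (proj₂ (proj₂ (nest (s≤s⁻¹ i≤k)))) , <⇒≤ (proj₂ (proj₂ (proj₂ (nest (k∸ i≤k)))))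

  -- Now the edge at `a` comes last in both rows, so `σ` fixes `k` and reverses `1, …, k − 1`. The
  -- special index is not a constructor pattern, whence the case distinction in `at-end`. The first
  -- row ends at `a`, so the separator is `suc a`.
  contains-rightBroken : ∀ {k′} (a : ℕ) (g : ℕ → ℕ) → V a → a < p a →
    (∀ {i} → i < k′ → V (g i) × p (g i) < a × a < g i × g i < p a) →
    (∀ {i j} → i < j → j < k′ → g i < g j × p (g j) < p (g i)) →
    Contains n p (suc k′) (rightBroken (suc k′))
  contains-rightBroken {k′} a g Va a<b nest down =
    two-rows σ α β (suc a) σ-range σσ q-σ edge α-inc β-inc sep
    where
    k = suc k′
    at-end : ℕ → ℕ → ℕ → ℕ
    at-end i x y with i ≟ k
    ... | yes _ = x
    ... | no  _ = y
    σ α β : ℕ → ℕ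
    σ i = at-end i k (k ∸ i)
    α i = at-end i a (p (g (k ∸ suc i)))
    β i = at-end i (p a) (g (pred i))
    at-k : ∀ {x y} → at-end k x y ≡ x
    at-k with k ≟ k
    ... | yes _  = refl
    ... | no k≢k = contradiction refl k≢k
    before : ∀ {i x y} → i < k → at-end i x y ≡ y
    before {i} i<k with i ≟ k
    ... | yes i≡k = contradiction i<k (<-irrefl i≡k)
    ... | no _    = refl
    case : ∀ (P : ℕ → Set) → P k → (∀ i → 1 ≤ i → i < k → P i) → ∀ i → 1 ≤ i → i ≤ k → P i
    case P Pk P< i 1≤i i≤k with m≤n⇒m<n∨m≡n i≤k
    ... | inj₁ i<k  = P< i 1≤i i<k
    ... | inj₂ refl = Pk
    k∸<k : ∀ {i} → 1 ≤ i → i < k → k ∸ i < k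
    k∸<k 1≤i i<k = ∸-monoʳ-< 1≤i (<⇒≤ i<k)
    k∸⁺ : ∀ {i} → 1 ≤ i → i < k → k ∸ suc i < k′
    k∸⁺ 1≤i i<k = ∸-monoʳ-< {o = 0} 1≤i (s≤s⁻¹ i<k)
    pred<k′ : ∀ {i} → 1 ≤ i → i < k → pred i < k′
    pred<k′ {suc i} _ i<k = s<s⁻¹ i<k
    σ-range : ∀ i → 1 ≤ i → i ≤ k → 1 ≤ σ i × σ i ≤ k
    σ-range = case _ (subst (λ s → 1 ≤ s × s ≤ k) (sym at-k) (s≤s z≤n , ≤-refl))
      λ i 1≤i i<k → subst (λ s → 1 ≤ s × s ≤ k) (sym (before i<k)) (m<n⇒0<n∸m i<k , m∸n≤m k i)
    σσ : ∀ i → 1 ≤ i → i ≤ k → σ (σ i) ≡ i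
    σσ = case _ (trans (cong σ at-k) at-k)
      λ i 1≤i i<k → trans (cong σ (before i<k)) (trans (before (k∸<k 1≤i i<k)) (m∸[m∸n]≡n (<⇒≤ i<k)))
    q-σ : ∀ i → 1 ≤ i → i ≤ k → rightBroken k i ≡ k + σ i × rightBroken k (k + i) ≡ σ i
    q-σ = case _
      ( trans (if-yes (≡⇒≡ᵇ k k refl)) (cong (k +_) (sym at-k))
      , trans (if-no (k+i≢k (s≤s z≤n))) (trans (if-yes (≡⇒≡ᵇ (k + k) (k + k) refl)) (sym at-k)))
      λ i 1≤i i<k →
        ( trans (if-no (<⇒≢ i<k ∘ ≡ᵇ⇒≡ i k))
            (trans (if-no (<⇒≢ (<-≤-trans i<k (m≤m+n k k)) ∘ ≡ᵇ⇒≡ i (k + k)))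
              (trans (+-∸-assoc k (<⇒≤ i<k)) (cong (k +_) (sym (before i<k)))))
        , trans (if-no (k+i≢k 1≤i))
            (trans (if-no (<⇒≢ (+-monoʳ-< k i<k) ∘ ≡ᵇ⇒≡ (k + i) (k + k)))
              (trans ([m+n]∸[m+o]≡n∸o k k i) (sym (before i<k)))))
      where
      k+i≢k : ∀ {i} → 1 ≤ i → ¬ T (k + i ≡ᵇ k)
      k+i≢k {i} 1≤i t = <-irrefl (sym (≡ᵇ⇒≡ (k + i) k t)) (m<m+n k 1≤i)
    edge : ∀ i → 1 ≤ i → i ≤ k → V (α i) × p (α i) ≡ β (σ i)
    edge = case _
      ( subst V (sym at-k) Va , trans (cong p at-k) (sym (trans (cong β at-k) at-k)))
      λ i 1≤i i<k → let Vg = proj₁ (nest (k∸⁺ 1≤i i<k)) in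
        subst V (sym (before i<k)) (range _ Vg)
      , trans (trans (cong p (before i<k)) (invol _ Vg))
          (sym (trans (cong β (before i<k)) (trans (before (k∸<k 1≤i i<k)) (cong g (pred[m∸n]≡m∸[1+n] k i)))))
    α-inc : ∀ i j → 1 ≤ i → i < j → j ≤ k → α i < α j
    α-inc i j 1≤i i<j j≤k = subst (_< α j) (sym (before i<k))
      (case (λ j → i < j → p (g (k ∸ suc i)) < α j)
        (λ _ → subst (p (g (k ∸ suc i)) <_) (sym at-k) (proj₁ (proj₂ (nest (k∸⁺ 1≤i i<k)))))
        (λ j _ j<k i<j → subst (p (g (k ∸ suc i)) <_) (sym (before j<k))
          (proj₂ (down (∸-monoʳ-< (s<s i<j) j<k) (k∸⁺ 1≤i i<k))))
        j (≤-trans (s≤s z≤n) i<j) j≤k i<j)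
      where i<k = <-≤-trans i<j j≤k
    β-inc : ∀ i j → 1 ≤ i → i < j → j ≤ k → β i < β j
    β-inc i j 1≤i i<j j≤k = subst (_< β j) (sym (before i<k))
      (case (λ j → i < j → g (pred i) < β j)
        (λ _ → subst (g (pred i) <_) (sym at-k) (proj₂ (proj₂ (proj₂ (nest (pred<k′ 1≤i i<k))))))
        (λ j 1≤j j<k i<j → subst (g (pred i) <_) (sym (before j<k))
          (proj₁ (down (pred-< 1≤i i<j) (pred<k′ 1≤j j<k))))
        j (≤-trans (s≤s z≤n) i<j) j≤k i<j)
      where
      i<k = <-≤-trans i<j j≤k
      pred-< : ∀ {i j} → 1 ≤ i → i < j → pred i < pred j
      pred-< {suc i} {suc j} _ i<j = s<s⁻¹ i<j
    sep : ∀ i → 1 ≤ i → i ≤ k → α i < suc a × suc a ≤ β i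
    sep = case _
      (subst (_< suc a) (sym at-k) ≤-refl , subst (suc a ≤_) (sym at-k) a<b)
      λ i 1≤i i<k →
        ( subst (_< suc a) (sym (before i<k)) (m<n⇒m<1+n (proj₁ (proj₂ (nest (k∸⁺ 1≤i i<k)))))
        , subst (suc a ≤_) (sym (before i<k)) (proj₁ (proj₂ (proj₂ (nest (pred<k′ 1≤i i<k))))))

-- The dichotomy: an edge with many crossings, or a long shortest path

module Dichotomy {n : ℕ} {p : ℕ → ℕ} (M : IsMatching n p) (1≤n : 1 ≤ n) where
  open IsMatching M
  open Chords M
  open Layers M 1≤n
  open Pins M
  open Patterns M
  open ErdősSzekeres p

  Up⇒< : ∀ {x y} → V x → V y → Up x y → p x < p y
  Up⇒< Vx Vy (x<y , px≤py) = ≤∧≢⇒< px≤py (λ eq → <-irrefl (p-injective Vx Vy eq) x<y)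

  lower-end : ∀ {v} → V v → V (lo v) × p (lo v) ≡ hi v × lo v < hi v
  lower-end {v} Vv with ends v
  ... | inj₁ (lo≡ , hi≡) = subst V (sym lo≡) Vv , trans (cong p lo≡) (sym hi≡)
        , ≤∧≢⇒< (m⊓n≤m⊔n v (p v)) (λ eq → noFix v Vv (trans (sym hi≡) (trans (sym eq) lo≡)))
  ... | inj₂ (lo≡ , hi≡) = subst V (sym lo≡) (range v Vv) , trans (cong p lo≡) (trans (invol v Vv) (sym hi≡))
        , ≤∧≢⇒< (m⊓n≤m⊔n v (p v)) (λ eq → noFix v Vv (trans (sym lo≡) (trans eq hi≡)))

  -- All the partners lie beyond `hi v`, so an increasing chain consists of pairwise crossing edges
  -- and a decreasing one of nested edges. Of a decreasing chain only `k′` members are used, because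
  -- the edge at `v` is the remaining edge of the broken nesting.
  many-rightArcs : ∀ {k′} v → V v → k′ * k′ < length (rightArcs v) →
    Contains n p (suc k′) (interleaving (suc k′)) ⊎ Contains n p (suc k′) (leftBroken (suc k′))
  many-rightArcs {k′} v Vv many with lower-end Vv
  ... | Va , b≡ , a<b with erdős-szekeres k′ k′ (rightArcs v) (AllPairsₚ.filter⁺ _ vertices-sorted) many
  ...   | inj₁ (g , g∈ , up) = inj₁ (contains-interleaving g (p ∘ g) (hi v)
          (λ i< → let (Vg , (_ , g<h) , h<pg) = ∈-rightArcs⁻ v (g∈ i<) in Vg , refl , g<h , <⇒≤ h<pg)
          (λ i<j j< → proj₁ (up i<j j<) , Up⇒< (proj₁ (∈-rightArcs⁻ v (g∈ (<-trans i<j j<)))) (proj₁ (∈-rightArcs⁻ v (g∈ j<))) (up i<j j<)))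
  ...   | inj₂ (g , g∈ , down) = inj₂ (contains-leftBroken (lo v) g Va (subst (lo v <_) (sym b≡) a<b)
          (λ {i} i< → let (Vg , (l<g , g<h) , h<pg) = ∈-rightArcs⁻ v (g∈ (m<n⇒m<1+n i<)) in
            Vg , l<g , subst (g i <_) (sym b≡) g<h , subst (_< p (g i)) (sym b≡) h<pg)
          (λ i<j j< → down i<j (m<n⇒m<1+n j<)))

  -- The mirror image: the partners lie before `lo v`, so they form the first row and the inner ends
  -- belong to the second.
  many-leftArcs : ∀ {k′} v → V v → k′ * k′ < length (leftArcs v) →
    Contains n p (suc k′) (interleaving (suc k′)) ⊎ Contains n p (suc k′) (rightBroken (suc k′))
  many-leftArcs {k′} v Vv many with lower-end Vv
  ... | Va , b≡ , a<b with erdős-szekeres k′ k′ (leftArcs v) (AllPairsₚ.filter⁺ _ vertices-sorted) many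
  ...   | inj₁ (g , g∈ , up) = inj₁ (contains-interleaving (p ∘ g) g (lo v)
          (λ i< → let (Vg , (l<g , _) , pg<l) = ∈-leftArcs⁻ v (g∈ i<) in range _ Vg , invol _ Vg , pg<l , <⇒≤ l<g)
          (λ i<j j< → Up⇒< (proj₁ (∈-leftArcs⁻ v (g∈ (<-trans i<j j<)))) (proj₁ (∈-leftArcs⁻ v (g∈ j<))) (up i<j j<) , proj₁ (up i<j j<)))
  ...   | inj₂ (g , g∈ , down) = inj₂ (contains-rightBroken (lo v) g Va (subst (lo v <_) (sym b≡) a<b)
          (λ {i} i< → let (Vg , (l<g , g<h) , pg<l) = ∈-leftArcs⁻ v (g∈ (m<n⇒m<1+n i<)) in
            Vg , pg<l , l<g , subst (g i <_) (sym b≡) g<h)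
          (λ i<j j< → down i<j (m<n⇒m<1+n j<)))

  length-neighbours : ∀ {A} v → length (rightArcs v) ≤ A → length (leftArcs v) ≤ A →
                      length (neighbours v) ≤ (A + A) + (A + A)
  length-neighbours {A} v r l = begin
    length (neighbours v)                          ≡⟨ length-++ (arcs v) ⟩
    length (arcs v) + length (map p (arcs v))      ≡⟨ cong (length (arcs v) +_) (length-map p (arcs v)) ⟩
    length (arcs v) + length (arcs v)              ≤⟨ +-mono-≤ few few ⟩
    (A + A) + (A + A)                              ∎
    where
    open ≤-Reasoning
    few : length (arcs v) ≤ A + A
    few = ≤-trans (≤-reflexive (length-++ (rightArcs v))) (+-mono-≤ r l)

  -- Distance drops by one at each step, so no edge repeats. A crossing of `e s` and `e t` with
  -- `suc s < t` would put `e s` at distance at most `suc (k ∸ t)`, less than its actual distance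
  -- `k ∸ s`.
  layer⇒path : ∀ d {v} → Layer d v → Σ (ℕ → ℕ) (RootedPath (suc d))
  layer⇒path d l with descent d l
  ... | e , _ , layer , cross = e , record
    { inV      = inV
    ; cross    = λ { t 1≤t t<k → cross t 1≤t (s≤s⁻¹ t<k) }
    ; induced  = induced
    ; distinct = λ s t 1≤s s<t t≤k → later 1≤s s<t t≤k ∘ (λ eq → subst (_∈ ball (k ∸ t)) eq (in-ball (≤-trans 1≤s (<⇒≤ s<t)) t≤k))
               , later 1≤s s<t t≤k ∘ λ eq → subst (_∈ ball (k ∸ t)) (trans (cong p eq) (invol _ (inV s 1≤s (≤-trans (<⇒≤ s<t) t≤k))))
                   (ball-p (k ∸ t) (in-ball (≤-trans 1≤s (<⇒≤ s<t)) t≤k))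
    ; root     = λ _ → at-root (subst (λ m → Layer m (e k)) (n∸n≡0 k) (layer k (s≤s z≤n) ≤-refl))
    }
    where
    k = suc d
    in-ball : ∀ {t} → 1 ≤ t → t ≤ k → e t ∈ ball (k ∸ t)
    in-ball {t} 1≤t t≤k = Layer⇒ball (k ∸ t) (layer t 1≤t t≤k)
    inV : ∀ t → 1 ≤ t → t ≤ k → V (e t)
    inV t 1≤t t≤k = ball-V (k ∸ t) (in-ball 1≤t t≤k)
    later : ∀ {s t} → 1 ≤ s → s < t → t ≤ k → e s ∉ ball (k ∸ t)
    later {s} {t} 1≤s s<t t≤k es∈ =
      <⇒≱ (∸-monoʳ-< s<t t≤k) (Layer-minimal (k ∸ s) (layer s 1≤s (≤-trans (<⇒≤ s<t) t≤k)) es∈)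
    induced : ∀ s t → 1 ≤ s → suc s < t → t ≤ k → ¬ Cross (e s) (e t)
    induced s t 1≤s s<t t≤k c = <⇒≱ (<-≤-trans (s<s (∸-monoʳ-< s<t t≤k)) (∸-monoʳ-< ≤-refl s<k))
      (Layer-minimal (k ∸ s) (layer s 1≤s (<⇒≤ s<k))
        (ball-step (k ∸ t) (in-ball 1≤t t≤k) Vs (Cross-sym Vs (inV t 1≤t t≤k) c)))
      where
      s<k = ≤-trans (<⇒≤ s<t) t≤k
      1≤t = ≤-trans 1≤s (<⇒≤ (<⇒≤ s<t))
      Vs  = inV s 1≤s (<⇒≤ s<k)
    at-root : ∀ {v} → v ∈ ball 0 → v ≡ 1 ⊎ p v ≡ 1
    at-root (here refl)         = inj₁ refl
    at-root (there (here refl)) = inj₂ (invol 1 V1)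

  -- An empty layer means that the ball has stopped growing; it then contains all `2n` vertices, and
  -- `length-ball` bounds `n`.
  layer-or-small : Indecomposable n p → ∀ B → (∀ v → V v → length (neighbours v) ≤ B) → ∀ d →
    (Σ ℕ λ v → Layer d v) ⊎ n ≤ suc B ^ d
  layer-or-small indec B deg zero = inj₁ (1 , here refl)
  layer-or-small indec B deg (suc d)
    with any? (λ v → ¬? (v ∈? ball d)) (ball (suc d))
  ... | yes found with find found
  ...   | v , v∈ , v∉ = inj₁ (v , v∈ , v∉)
  layer-or-small indec B deg (suc d) | no none = inj₂ (*-cancelˡ-≤ 2 (begin
    2 * n                ≡⟨ cong (n +_) (+-identityʳ n) ⟩
    n + n                ≡⟨ length-applyUpTo suc (n + n) ⟨
    length vertices      ≤⟨ Unique-⊆⇒length≤ (<-sorted⇒Unique vertices-sorted) (stable-ball-full indec d stable ∘ ∈-vertices⁻) ⟩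
    length (ball d)      ≤⟨ length-ball B deg d ⟩
    -- The ball that stopped has radius `d`, one less than the empty layer; the exponent is raised
    -- only to match the stated bound.
    2 * suc B ^ d        ≤⟨ *-monoʳ-≤ 2 (^-monoʳ-≤ (suc B) (n≤1+n d)) ⟩
    2 * suc B ^ suc d    ∎))
    where
    open ≤-Reasoning
    stable : ∀ {v} → v ∈ ball (suc d) → v ∈ ball d
    stable v∈ = decidable-stable (_ ∈? ball d) (λ v∉ → none (lose v∈ v∉))

  few-arcs? : ∀ A v → Dec (length (rightArcs v) ≤ A × length (leftArcs v) ≤ A)
  few-arcs? A v = (length (rightArcs v) ≤? A) ×-dec (length (leftArcs v) ≤? A)

  patterns-or-pins : Indecomposable n p → ∀ j → suc ((j * j + j * j) + (j * j + j * j)) ^ j < n →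
    let k = suc j in
    Contains n p k (leftBroken k) ⊎ Contains n p k (rightBroken k) ⊎ Contains n p k (interleaving k) ⊎
    Σ (ℕ → ℕ) (λ q → IsMatching k q × IsProperPinSeq k q × Contains n p k q)
  patterns-or-pins indec j big with all? (few-arcs? (j * j)) vertices
  ... | yes few with layer-or-small indec _
        (λ v Vv → let (r , l) = All.lookup few (∈-vertices Vv) in length-neighbours v r l) j
  ...   | inj₂ n≤ = contradiction n≤ (<⇒≱ big)
  ...   | inj₁ (v , l) with layer⇒path j l
  ...     | e , P = inj₂ (inj₂ (inj₂ (q , q-matching , q-proper , q-contained)))
    where open Restriction M P
  patterns-or-pins indec j big | no ¬few with find (¬All⇒Any¬ (few-arcs? (j * j)) vertices ¬few)
  ... | v , v∈ , many with length (rightArcs v) ≤? j * j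
  ...   | no  r = [ inj₂ ∘ inj₂ ∘ inj₁ , inj₁ ]′ (many-rightArcs v (∈-vertices⁻ v∈) (≰⇒> r))
  ...   | yes r = [ inj₂ ∘ inj₂ ∘ inj₁ , inj₂ ∘ inj₁ ]′
                    (many-leftArcs v (∈-vertices⁻ v∈) (≰⇒> (λ l → many (r , l))))

-- Arithmetic of the bound

degree-bound : ∀ j → suc ((j * j + j * j) + (j * j + j * j)) ≤ (2 * suc j) ^ 2
degree-bound j = subst (suc ((j * j + j * j) + (j * j + j * j)) ≤_) (sym expand) (s≤s (m≤m+n _ (3 + 8 * j)))
  where
  open +-*-Solver
  expand : (2 * suc j) ^ 2 ≡ suc ((j * j + j * j) + (j * j + j * j) + (3 + 8 * j))
  expand = solve 1 (λ j → (con 2 :* (con 1 :+ j)) :^ 2 :=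
    con 1 :+ ((j :* j :+ j :* j) :+ (j :* j :+ j :* j) :+ (con 3 :+ con 8 :* j))) refl j

-- With `k = suc j`, growth by at most `(2k)²` over `k − 1` steps gives exponent `2k − 2`; the two
-- remaining factors `2k` make the inequality strict.
small-ball : ∀ j → suc ((j * j + j * j) + (j * j + j * j)) ^ j < (2 * suc j) ^ (2 * suc j)
small-ball j = begin-strict
  suc A ^ j                        ≤⟨ ^-monoˡ-≤ j (degree-bound j) ⟩
  ((2 * suc j) ^ 2) ^ j            ≡⟨ ^-*-assoc (2 * suc j) 2 j ⟩
  (2 * suc j) ^ (2 * j)            <⟨ ^-monoʳ-< (2 * suc j) (*-monoʳ-≤ 2 (s≤s z≤n)) (*-monoʳ-< 2 (n<1+n j)) ⟩
  (2 * suc j) ^ (2 * suc j)        ∎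
  where
  open ≤-Reasoning
  A = (j * j + j * j) + (j * j + j * j)

theorem1p1 : (k : ℕ) → 1 ≤ k → (n : ℕ) → (p : ℕ → ℕ) → IsMatching n p → Indecomposable n p → (2 * k) ^ (2 * k) ≤ n →
    Contains n p k (leftBroken k) ⊎ Contains n p k (rightBroken k) ⊎ Contains n p k (interleaving k) ⊎
    Σ (ℕ → ℕ) (λ q → IsMatching k q × IsProperPinSeq k q × Contains n p k q)
theorem1p1 (suc j) _ n p M indec big =
  Dichotomy.patterns-or-pins M (≤-trans (s≤s z≤n) n-large) indec j n-large
  where
  n-large : suc ((j * j + j * j) + (j * j + j * j)) ^ j < n
  n-large = <-≤-trans (small-ball j) big
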